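{- Let $d\ge 3$ be odd, let $k$ be even and let $V=(\mathbb{C}^k)^{\otimes d}$. For an integer $n\ge 0$ write $W_n=\mathrm{HWV}_{(k\times n)^d}\bigwedge V$, where $(k\times n)^d$ is the $d$-tuple all of whose entries are $k\times n=(n,\ldots,n)$ ($k$ entries). Suppose that the following property $\mathrm{HLP}_{\varnothing,k}$ holds: for each integer $n\in[0,k^{d-1}/2]$ the map $$L^{k^{d-1}-2n}:\ W_n\longrightarrow W_{k^{d-1}-n},\qquad L(v)=\omega\wedge v,$$ is an isomorphism. Then $\mathrm{AT}_d(k)\neq 0$.
   Context: The group $\mathrm{GL}(k)^{\times d}$ acts on $V=(\mathbb{C}^k)^{\otimes d}$ multilinearly and hence on $\bigwedge V$. A vector $v\in\bigwedge V$ is a weight vector of weight $\pmb{\mu}=(\mu^{(1)},\ldots,\mu^{(d)})$, $\mu^{(j)}\in\mathbb{Z}^k$, if every tuple of diagonal matrices $(\mathrm{diag}(a^{(1)}_1,\ldots,a^{(1)}_k),\ldots,\mathrm{diag}(a^{(d)}_1,\ldots,a^{(d)}_k))$ acts on $v$ as the scalar $\prod_j\prod_i (a^{(j)}_i)^{\mu^{(j)}_i}$. $\mathrm{HWV}_{\pmb{\mu}}\bigwedge V$ is the space consisting of $0$ and the nonzero weight vectors of weight $\pmb{\mu}$ invariant under $U(k)^{\times d}$, with $U(k)$ the group of upper unitriangular matrices. The Cayley form is $$\omega=\omega_{d,k}=\sum_{\pi_1,\ldots,\pi_d\in S_k}\mathrm{sgn}(\pi_1\cdots\pi_d)\bigwedge_{i=1}^k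 \left(e_{\pi_1(i)}\otimes\cdots\otimes e_{\pi_d(i)}\right)\in\bigwedge^k V,$$ where $e_1,\ldots,e_k$ is the standard basis of $\mathbb{C}^k$. Alon--Tarsi numbers: for $\ell\in[d]=\{1,\ldots,d\}$ and $i\in[k]$, the $i$-th slice of the cube $[k]^d$ in direction $\ell$ is the set of elements of $[k]^d$ whose $\ell$-th coordinate equals $i$. A $d$-dimensional Latin hypercube is a map $C:[k]^d\to[k^{d-1}]$ that is bijective when restricted to each slice. For a slice $S$, the $S$-permutation of $C$ is the permutation of $[k^{d-1}]$ formed by the values of $C$ on $S$ read in lexicographic order, and $\mathrm{sgn}(C)$ is the product of the signs of the $S$-permutations over all $dk$ slices $S$. Then $\mathrm{AT}_d(k)=\sum_C\mathrm{sgn}(C)$, the sum over all $d$-dimensional Latin hypercubes $C:[k]^d\to[k^{d-1}]$. -}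

module Defs where

open import Algebra.Bundles using (CommutativeRing; Ring)
open import Algebra.Module.Bundles using (LeftModule)
open import Algebra.Module.Morphism.Structures using (module LeftModuleMorphisms)
import Algebra.Consequences.Setoid as Consequences
import Algebra.Properties.CommutativeSemigroup as CommutativeSemigroupProperties
import Algebra.Properties.CommutativeMonoid.Sum as CommutativeMonoidSum
import Algebra.Properties.Ring as RingProperties
import Algebra.Properties.Semiring.Exp as SemiringExp
import Algebra.Properties.Semiring.Sum as SemiringSum
open import Data.Bool.Base using (if_then_else_)
open import Data.Fin.Base using (Fin; zero; suc; _<_; finToFun; funToFin)
open import Data.Fin.Properties using (_≟_; _<?_; all?; any?)
open import Data.Integer.Base as ℤ using (ℤ; -[1+_]; _◃_)
open import Data.List.Base as List using (List; allFin; cartesianProductWith; filter; foldr)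
open import Data.Nat.Base as ℕ using (ℕ; zero; suc; NonZero; _^_; _∸_)
open import Data.Nat.GeneralisedArithmetic using (fold)
import Data.Nat.Properties as ℕ
open import Data.Product.Base using (Σ; ∃; _×_; _,_; proj₁; proj₂)
open import Data.Rational.Base as ℚ using (ℚ; 0ℚ; 1ℚ; ½; ∣_∣)
import Data.Rational.Properties as ℚ
open import Data.Sign.Base as Sign using (Sign)
import Data.Sign.Properties as Sign
open import Data.Vec.Functional as Vector using (Vector; updateAt; insertAt)
open import Function.Base using (id; _∘_; const)
open import Function.Definitions using (Injective; Surjective; Bijective)
open import Level using (Level; 0ℓ; _⊔_)
open import Relation.Binary.Bundles using (Setoid)
open import Relation.Binary.PropositionalEquality as ≡ using (_≡_; _≢_; refl)
import Relation.Binary.Reasoning.Setoid as SetoidReasoning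
open import Relation.Nullary.Decidable using (Dec; yes; no; does; map′; _×-dec_; _→-dec_)

-- ℝ as Cauchy sequences of rationals (the modulus of convergence is part of
-- the data), two sequences being equal when their difference tends to 0.

module Real where

  private
    open RingProperties (CommutativeRing.ring ℚ.+-*-commutativeRing) using (-‿involutive)
    open CommutativeSemigroupProperties (CommutativeRing.+-commutativeSemigroup ℚ.+-*-commutativeRing)
      using (interchange)

    Eventually : (ℕ → Set) → Set
    Eventually P = ∃ λ N → ∀ n → N ℕ.≤ n → P n

    _∧ᵉ_ : ∀ {P Q} → Eventually P → Eventually Q → Eventually (λ n → P n × Q n)
    (M , p) ∧ᵉ (N , q) = M ℕ.⊔ N , λ n M⊔N≤n →
      p n (ℕ.≤-trans (ℕ.m≤m⊔n M N) M⊔N≤n) , q n (ℕ.≤-trans (ℕ.m≤n⊔m M N) M⊔N≤n)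

  IsCauchy : (ℕ → ℚ) → Set
  IsCauchy x = ∀ ε → 0ℚ ℚ.< ε →
    ∃ λ N → ∀ m n → N ℕ.≤ m → N ℕ.≤ n → ∣ x m ℚ.- x n ∣ ℚ.< ε

  ℝ : Set
  ℝ = Σ (ℕ → ℚ) IsCauchy

  infix 4 _≈_

  _≈_ : ℝ → ℝ → Set
  (x , _) ≈ (y , _) = ∀ ε → 0ℚ ℚ.< ε →
    ∃ λ N → ∀ n → N ℕ.≤ n → ∣ x n ℚ.- y n ∣ ℚ.< ε

  private
    ∣p-p∣≡0 : ∀ p → ∣ p ℚ.- p ∣ ≡ 0ℚ
    ∣p-p∣≡0 p = ≡.cong ∣_∣ (ℚ.+-inverseʳ p)

    ∣p-q∣≡∣q-p∣ : ∀ p q → ∣ p ℚ.- q ∣ ≡ ∣ q ℚ.- p ∣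
    ∣p-q∣≡∣q-p∣ p q = ≡.trans (≡.sym (ℚ.∣-p∣≡∣p∣ (p ℚ.- q))) (≡.cong ∣_∣ (begin
      ℚ.- (p ℚ.- q)         ≡⟨ ℚ.neg-distrib-+ p (ℚ.- q) ⟩
      ℚ.- p ℚ.- (ℚ.- q)     ≡⟨ ≡.cong (ℚ.- p ℚ.+_) (-‿involutive q) ⟩
      ℚ.- p ℚ.+ q           ≡⟨ ℚ.+-comm (ℚ.- p) q ⟩
      q ℚ.- p               ∎))
      where open ≡.≡-Reasoning

    telescope : ∀ p q r → (p ℚ.- q) ℚ.+ (q ℚ.- r) ≡ p ℚ.- r
    telescope p q r = begin
      (p ℚ.- q) ℚ.+ (q ℚ.- r)          ≡⟨ ℚ.+-assoc p (ℚ.- q) (q ℚ.- r) ⟩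
      p ℚ.+ (ℚ.- q ℚ.+ (q ℚ.- r))      ≡⟨ ≡.cong (p ℚ.+_) (ℚ.+-assoc (ℚ.- q) q (ℚ.- r)) ⟨
      p ℚ.+ ((ℚ.- q ℚ.+ q) ℚ.- r)      ≡⟨ ≡.cong (λ z → p ℚ.+ (z ℚ.- r)) (ℚ.+-inverseˡ q) ⟩
      p ℚ.+ (0ℚ ℚ.- r)                 ≡⟨ ≡.cong (p ℚ.+_) (ℚ.+-identityˡ (ℚ.- r)) ⟩
      p ℚ.- r                          ∎
      where open ≡.≡-Reasoning

    *-distribˡ-- : ∀ p q r → p ℚ.* (q ℚ.- r) ≡ p ℚ.* q ℚ.- p ℚ.* r
    *-distribˡ-- p q r = ≡.trans (ℚ.*-distribˡ-+ p q (ℚ.- r))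
      (≡.cong (p ℚ.* q ℚ.+_) (≡.sym (ℚ.neg-distribʳ-* p r)))

    ∣p-r∣≤ : ∀ p q r → ∣ p ℚ.- r ∣ ℚ.≤ ∣ p ℚ.- q ∣ ℚ.+ ∣ q ℚ.- r ∣
    ∣p-r∣≤ p q r = ≡.subst (λ z → ∣ z ∣ ℚ.≤ ∣ p ℚ.- q ∣ ℚ.+ ∣ q ℚ.- r ∣) (telescope p q r)
      (ℚ.∣p+q∣≤∣p∣+∣q∣ (p ℚ.- q) (q ℚ.- r))

    -- Every error estimate below has the form B δ + B δ = ε.
    split : ∀ B → 0ℚ ℚ.< B → ∀ ε → 0ℚ ℚ.< ε →
            ∃ λ δ → 0ℚ ℚ.< δ × B ℚ.* δ ℚ.+ B ℚ.* δ ≡ ε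
    split B 0<B ε 0<ε = δ , ℚ.positive⁻¹ δ {{δ>0}} , (begin
      B ℚ.* δ ℚ.+ B ℚ.* δ         ≡⟨ ≡.cong₂ ℚ._+_ Bδ≡½ε Bδ≡½ε ⟩
      ½ ℚ.* ε ℚ.+ ½ ℚ.* ε         ≡⟨ ℚ.*-distribʳ-+ ε ½ ½ ⟨
      1ℚ ℚ.* ε                    ≡⟨ ℚ.*-identityˡ ε ⟩
      ε                           ∎)
      where
      open ≡.≡-Reasoning
      instance
        B>0 : ℚ.Positive B
        B>0 = ℚ.positive 0<B
        ε>0 : ℚ.Positive ε
        ε>0 = ℚ.positive 0<ε
        B≢0 : ℚ.NonZero B
        B≢0 = ℚ.pos⇒nonZero B
        1/B>0 : ℚ.Positive (ℚ.1/ B)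
        1/B>0 = ℚ.1/pos⇒pos B
        ½ε>0 : ℚ.Positive (½ ℚ.* ε)
        ½ε>0 = ℚ.pos*pos⇒pos ½ ε
      δ = ℚ.1/ B ℚ.* (½ ℚ.* ε)
      δ>0 : ℚ.Positive δ
      δ>0 = ℚ.pos*pos⇒pos (ℚ.1/ B) (½ ℚ.* ε)
      Bδ≡½ε : B ℚ.* δ ≡ ½ ℚ.* ε
      Bδ≡½ε = begin
        B ℚ.* (ℚ.1/ B ℚ.* (½ ℚ.* ε))   ≡⟨ ℚ.*-assoc B (ℚ.1/ B) (½ ℚ.* ε) ⟨
        (B ℚ.* ℚ.1/ B) ℚ.* (½ ℚ.* ε)   ≡⟨ ≡.cong (ℚ._* (½ ℚ.* ε)) (ℚ.*-inverseʳ B) ⟩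
        1ℚ ℚ.* (½ ℚ.* ε)               ≡⟨ ℚ.*-identityˡ (½ ℚ.* ε) ⟩
        ½ ℚ.* ε                        ∎

    halve : ∀ ε → 0ℚ ℚ.< ε → ∃ λ δ → 0ℚ ℚ.< δ × δ ℚ.+ δ ≡ ε
    halve ε 0<ε =
      let (δ , 0<δ , eq) = split 1ℚ (ℚ.positive⁻¹ 1ℚ) ε 0<ε
      in δ , 0<δ , ≡.trans (≡.sym (≡.cong₂ ℚ._+_ (ℚ.*-identityˡ δ) (ℚ.*-identityˡ δ))) eq

    +-estimate : ∀ {a a′ b b′ δ ε} → δ ℚ.+ δ ≡ ε →
                 ∣ a ℚ.- a′ ∣ ℚ.< δ → ∣ b ℚ.- b′ ∣ ℚ.< δ →
                 ∣ (a ℚ.+ b) ℚ.- (a′ ℚ.+ b′) ∣ ℚ.< ε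
    +-estimate {a} {a′} {b} {b′} {δ} {ε} eq p q = begin-strict
      ∣ (a ℚ.+ b) ℚ.- (a′ ℚ.+ b′) ∣
        ≡⟨ ≡.cong (λ z → ∣ (a ℚ.+ b) ℚ.+ z ∣) (ℚ.neg-distrib-+ a′ b′) ⟩
      ∣ (a ℚ.+ b) ℚ.+ (ℚ.- a′ ℚ.- b′) ∣
        ≡⟨ ≡.cong ∣_∣ (interchange a b (ℚ.- a′) (ℚ.- b′)) ⟩
      ∣ (a ℚ.- a′) ℚ.+ (b ℚ.- b′) ∣
        ≤⟨ ℚ.∣p+q∣≤∣p∣+∣q∣ (a ℚ.- a′) (b ℚ.- b′) ⟩
      ∣ a ℚ.- a′ ∣ ℚ.+ ∣ b ℚ.- b′ ∣
        <⟨ ℚ.+-mono-< p q ⟩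
      δ ℚ.+ δ
        ≡⟨ eq ⟩
      ε ∎
      where open ℚ.≤-Reasoning

    ∣pq∣-estimate : ∀ {p q B δ} → 0ℚ ℚ.< B → ∣ p ∣ ℚ.< B → ∣ q ∣ ℚ.< δ →
                    ∣ p ℚ.* q ∣ ℚ.≤ B ℚ.* δ
    ∣pq∣-estimate {p} {q} {B} {δ} 0<B p<B q<δ = begin
      ∣ p ℚ.* q ∣        ≡⟨ ℚ.∣p*q∣≡∣p∣*∣q∣ p q ⟩
      ∣ p ∣ ℚ.* ∣ q ∣    ≤⟨ ℚ.*-monoʳ-≤-nonNeg ∣ q ∣ {{ℚ.∣-∣-nonNeg q}} (ℚ.<⇒≤ p<B) ⟩
      B ℚ.* ∣ q ∣        ≤⟨ ℚ.*-monoˡ-≤-nonNeg B {{ℚ.pos⇒nonNeg B {{ℚ.positive 0<B}}}} (ℚ.<⇒≤ q<δ) ⟩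
      B ℚ.* δ            ∎
      where open ℚ.≤-Reasoning

    ∣pq∣-estimate-< : ∀ {p q B δ} → 0ℚ ℚ.< B → ∣ p ∣ ℚ.< B → ∣ q ∣ ℚ.< δ →
                      ∣ p ℚ.* q ∣ ℚ.< B ℚ.* δ
    ∣pq∣-estimate-< {p} {q} {B} {δ} 0<B p<B q<δ = begin-strict
      ∣ p ℚ.* q ∣        ≡⟨ ℚ.∣p*q∣≡∣p∣*∣q∣ p q ⟩
      ∣ p ∣ ℚ.* ∣ q ∣    ≤⟨ ℚ.*-monoʳ-≤-nonNeg ∣ q ∣ {{ℚ.∣-∣-nonNeg q}} (ℚ.<⇒≤ p<B) ⟩
      B ℚ.* ∣ q ∣        <⟨ ℚ.*-monoʳ-<-pos B {{ℚ.positive 0<B}} q<δ ⟩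
      B ℚ.* δ            ∎
      where open ℚ.≤-Reasoning

    *-estimate : ∀ {a a′ b b′ B δ ε} → 0ℚ ℚ.< B → B ℚ.* δ ℚ.+ B ℚ.* δ ≡ ε →
                 ∣ a ∣ ℚ.< B → ∣ b′ ∣ ℚ.< B →
                 ∣ a ℚ.- a′ ∣ ℚ.< δ → ∣ b ℚ.- b′ ∣ ℚ.< δ →
                 ∣ a ℚ.* b ℚ.- a′ ℚ.* b′ ∣ ℚ.< ε
    *-estimate {a} {a′} {b} {b′} {B} {δ} {ε} 0<B eq a<B b′<B p q = begin-strict
      ∣ a ℚ.* b ℚ.- a′ ℚ.* b′ ∣
        ≤⟨ ∣p-r∣≤ (a ℚ.* b) (a ℚ.* b′) (a′ ℚ.* b′) ⟩
      ∣ a ℚ.* b ℚ.- a ℚ.* b′ ∣ ℚ.+ ∣ a ℚ.* b′ ℚ.- a′ ℚ.* b′ ∣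
        ≡⟨ ≡.cong₂ (λ u v → ∣ u ∣ ℚ.+ ∣ v ∣) (≡.sym (*-distribˡ-- a b b′))
             (≡.trans (≡.cong₂ ℚ._-_ (ℚ.*-comm a b′) (ℚ.*-comm a′ b′)) (≡.sym (*-distribˡ-- b′ a a′))) ⟩
      ∣ a ℚ.* (b ℚ.- b′) ∣ ℚ.+ ∣ b′ ℚ.* (a ℚ.- a′) ∣
        <⟨ ℚ.+-mono-<-≤ (∣pq∣-estimate-< {a} 0<B a<B q) (∣pq∣-estimate {b′} 0<B b′<B p) ⟩
      B ℚ.* δ ℚ.+ B ℚ.* δ
        ≡⟨ eq ⟩
      ε ∎
      where open ℚ.≤-Reasoning

    bounded : ((x , _) : ℝ) → ∃ λ B → 0ℚ ℚ.< B × Eventually (λ n → ∣ x n ∣ ℚ.< B)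
    bounded (x , cx) =
      let (N , h) = cx 1ℚ (ℚ.positive⁻¹ 1ℚ)
      in 1ℚ ℚ.+ ∣ x N ∣ ,
         ℚ.+-mono-<-≤ (ℚ.positive⁻¹ 1ℚ) (ℚ.0≤∣p∣ (x N)) , N , λ n N≤n → begin-strict
           ∣ x n ∣
             ≡⟨ ≡.cong ∣_∣ (lem (x n) (x N)) ⟩
           ∣ (x n ℚ.- x N) ℚ.+ x N ∣
             ≤⟨ ℚ.∣p+q∣≤∣p∣+∣q∣ (x n ℚ.- x N) (x N) ⟩
           ∣ x n ℚ.- x N ∣ ℚ.+ ∣ x N ∣
             <⟨ ℚ.+-monoˡ-< ∣ x N ∣ (h n N N≤n ℕ.≤-refl) ⟩
           1ℚ ℚ.+ ∣ x N ∣ ∎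
      where
      open ℚ.≤-Reasoning
      lem : ∀ p q → p ≡ (p ℚ.- q) ℚ.+ q
      lem p q = ≡.sym (≡.trans (ℚ.+-assoc p (ℚ.- q) q)
        (≡.trans (≡.cong (p ℚ.+_) (ℚ.+-inverseˡ q)) (ℚ.+-identityʳ p)))

    bounded₂ : ((x , _) (y , _) : ℝ) →
               ∃ λ B → 0ℚ ℚ.< B × Eventually (λ n → ∣ x n ∣ ℚ.< B × ∣ y n ∣ ℚ.< B)
    bounded₂ x y =
      let (A , 0<A , ea) = bounded x
          (B , 0<B , eb) = bounded y
          (N , h) = ea ∧ᵉ eb
      in A ℚ.+ B , ℚ.+-mono-< 0<A 0<B , N , λ n N≤n →
         let (p , q) = h n N≤n in
         ℚ.<-trans p (≡.subst (ℚ._< A ℚ.+ B) (ℚ.+-identityʳ A) (ℚ.+-monoʳ-< A 0<B)) ,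
         ℚ.<-trans q (≡.subst (ℚ._< A ℚ.+ B) (ℚ.+-identityˡ B) (ℚ.+-monoˡ-< B 0<A))

    +-cauchy : ∀ x y → IsCauchy x → IsCauchy y → IsCauchy (λ n → x n ℚ.+ y n)
    +-cauchy x y cx cy ε 0<ε =
      let (δ , 0<δ , eq) = halve ε 0<ε
          (M , h) = cx δ 0<δ
          (N , g) = cy δ 0<δ
      in M ℕ.⊔ N , λ m n p q →
         +-estimate {x m} {x n} {y m} {y n} eq
           (h m n (ℕ.≤-trans (ℕ.m≤m⊔n M N) p) (ℕ.≤-trans (ℕ.m≤m⊔n M N) q))
           (g m n (ℕ.≤-trans (ℕ.m≤n⊔m M N) p) (ℕ.≤-trans (ℕ.m≤n⊔m M N) q))

    *-cauchy : ∀ x y → IsCauchy x → IsCauchy y → IsCauchy (λ n → x n ℚ.* y n)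
    *-cauchy x y cx cy ε 0<ε =
      let (B , 0<B , K , b) = bounded₂ (x , cx) (y , cy)
          (δ , 0<δ , eq) = split B 0<B ε 0<ε
          (M , h) = cx δ 0<δ
          (N , g) = cy δ 0<δ
      in K ℕ.⊔ (M ℕ.⊔ N) , λ m n p q →
         *-estimate {x m} {x n} {y m} {y n} 0<B eq
           (proj₁ (b m (ℕ.≤-trans (ℕ.m≤m⊔n K (M ℕ.⊔ N)) p)))
           (proj₂ (b n (ℕ.≤-trans (ℕ.m≤m⊔n K (M ℕ.⊔ N)) q)))
           (h m n (ℕ.≤-trans (ℕ.m≤m⊔n M N) (ℕ.≤-trans (ℕ.m≤n⊔m K _) p))
                  (ℕ.≤-trans (ℕ.m≤m⊔n M N) (ℕ.≤-trans (ℕ.m≤n⊔m K _) q)))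
           (g m n (ℕ.≤-trans (ℕ.m≤n⊔m M N) (ℕ.≤-trans (ℕ.m≤n⊔m K _) p))
                  (ℕ.≤-trans (ℕ.m≤n⊔m M N) (ℕ.≤-trans (ℕ.m≤n⊔m K _) q)))

    ∣-a--b∣≡∣a-b∣ : ∀ a b → ∣ (ℚ.- a) ℚ.- (ℚ.- b) ∣ ≡ ∣ a ℚ.- b ∣
    ∣-a--b∣≡∣a-b∣ a b = ≡.trans
      (≡.cong ∣_∣ (≡.sym (ℚ.neg-distrib-+ a (ℚ.- b)))) (ℚ.∣-p∣≡∣p∣ (a ℚ.- b))

    -cauchy : ∀ x → IsCauchy x → IsCauchy (λ n → ℚ.- x n)
    -cauchy x cx ε 0<ε =
      let (N , h) = cx ε 0<ε
      in N , λ m n p q →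
         ≡.subst (ℚ._< ε) (≡.sym (∣-a--b∣≡∣a-b∣ (x m) (x n))) (h m n p q)

  infixl 6 _+_
  infixl 7 _*_
  infix 8 -_

  _+_ _*_ : ℝ → ℝ → ℝ
  (x , cx) + (y , cy) = (λ n → x n ℚ.+ y n) , +-cauchy x y cx cy
  (x , cx) * (y , cy) = (λ n → x n ℚ.* y n) , *-cauchy x y cx cy

  -_ : ℝ → ℝ
  - (x , cx) = (λ n → ℚ.- x n) , -cauchy x cx

  fromℚ : ℚ → ℝ
  fromℚ p = const p , λ ε 0<ε → 0 , λ m n _ _ → ≡.subst (ℚ._< ε) (≡.sym (∣p-p∣≡0 p)) 0<ε

  private
    pointwise : ∀ {x y : ℝ} → (∀ n → proj₁ x n ≡ proj₁ y n) → x ≈ y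
    pointwise {x , _} {y , _} eq ε 0<ε = 0 , λ n _ → ≡.subst (ℚ._< ε)
      (≡.sym (≡.trans (≡.cong (λ q → ∣ x n ℚ.- q ∣) (≡.sym (eq n))) (∣p-p∣≡0 (x n)))) 0<ε

    ≈-sym : ∀ {x y} → x ≈ y → y ≈ x
    ≈-sym {x , _} {y , _} h ε 0<ε =
      let (N , g) = h ε 0<ε
      in N , λ n p → ≡.subst (ℚ._< ε) (∣p-q∣≡∣q-p∣ (x n) (y n)) (g n p)

    ≈-trans : ∀ {x y z} → x ≈ y → y ≈ z → x ≈ z
    ≈-trans {x , _} {y , _} {z , _} h g ε 0<ε =
      let (δ , 0<δ , eq) = halve ε 0<ε
          (N , f) = h δ 0<δ ∧ᵉ g δ 0<δ
      in N , λ n p → ℚ.≤-<-trans (∣p-r∣≤ (x n) (y n) (z n))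
         (≡.subst (∣ x n ℚ.- y n ∣ ℚ.+ ∣ y n ℚ.- z n ∣ ℚ.<_) eq (ℚ.+-mono-< (proj₁ (f n p)) (proj₂ (f n p))))

    +-cong : ∀ {x x′ y y′} → x ≈ x′ → y ≈ y′ → x + y ≈ x′ + y′
    +-cong {x , _} {x′ , _} {y , _} {y′ , _} h g ε 0<ε =
      let (δ , 0<δ , eq) = halve ε 0<ε
          (N , f) = h δ 0<δ ∧ᵉ g δ 0<δ
      in N , λ n p →
         +-estimate {x n} {x′ n} {y n} {y′ n} eq (proj₁ (f n p)) (proj₂ (f n p))

    *-cong : ∀ {x x′ y y′} → x ≈ x′ → y ≈ y′ → x * y ≈ x′ * y′
    *-cong {X@(x , _)} {x′ , _} {y , _} {Y′@(y′ , _)} h g ε 0<ε =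
      let (B , 0<B , b) = bounded₂ X Y′
          (δ , 0<δ , eq) = split B 0<B ε 0<ε
          (N , f) = b ∧ᵉ (h δ 0<δ ∧ᵉ g δ 0<δ)
      in N , λ n p → let ((bx , by′) , hn , gn) = f n p in
         *-estimate {x n} {x′ n} {y n} {y′ n} 0<B eq bx by′ hn gn

    -‿cong : ∀ {x y} → x ≈ y → - x ≈ - y
    -‿cong {x , _} {y , _} h ε 0<ε =
      let (N , g) = h ε 0<ε
      in N , λ n p → ≡.subst (ℚ._< ε) (≡.sym (∣-a--b∣≡∣a-b∣ (x n) (y n))) (g n p)

  ℝ-commutativeRing : CommutativeRing 0ℓ 0ℓ
  ℝ-commutativeRing = record
    { Carrier = ℝ ; _≈_ = _≈_ ; _+_ = _+_ ; _*_ = _*_ ; -_ = -_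
    ; 0# = fromℚ 0ℚ ; 1# = fromℚ 1ℚ
    ; isCommutativeRing = record
      { isRing = record
        { +-isAbelianGroup = record
          { isGroup = record
            { isMonoid = record
              { isSemigroup = record
                { isMagma = record
                  { isEquivalence = record
                    { refl = λ {x} → pointwise {x} {x} λ _ → refl
                    ; sym = λ {x} {y} → ≈-sym {x} {y}
                    ; trans = λ {x} {y} {z} → ≈-trans {x} {y} {z}
                    }
                  ; ∙-cong = λ {x} {x′} {y} {y′} → +-cong {x} {x′} {y} {y′}
                  }
                ; assoc = λ x y z → pointwise {x + y + z} {x + (y + z)}
                    λ n → ℚ.+-assoc (proj₁ x n) (proj₁ y n) (proj₁ z n)
                }
              ; identity = (λ x → pointwise {fromℚ 0ℚ + x} {x} λ n → ℚ.+-identityˡ (proj₁ x n))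
                         , (λ x → pointwise {x + fromℚ 0ℚ} {x} λ n → ℚ.+-identityʳ (proj₁ x n))
              }
            ; inverse = (λ x → pointwise { - x + x} {fromℚ 0ℚ} λ n → ℚ.+-inverseˡ (proj₁ x n))
                      , (λ x → pointwise {x + - x} {fromℚ 0ℚ} λ n → ℚ.+-inverseʳ (proj₁ x n))
            ; ⁻¹-cong = λ {x} {y} → -‿cong {x} {y}
            }
          ; comm = λ x y → pointwise {x + y} {y + x} λ n → ℚ.+-comm (proj₁ x n) (proj₁ y n)
          }
        ; *-cong = λ {x} {x′} {y} {y′} → *-cong {x} {x′} {y} {y′}
        ; *-assoc = λ x y z → pointwise {x * y * z} {x * (y * z)}
            λ n → ℚ.*-assoc (proj₁ x n) (proj₁ y n) (proj₁ z n)
        ; *-identity = (λ x → pointwise {fromℚ 1ℚ * x} {x} λ n → ℚ.*-identityˡ (proj₁ x n))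
                     , (λ x → pointwise {x * fromℚ 1ℚ} {x} λ n → ℚ.*-identityʳ (proj₁ x n))
        ; distrib = (λ x y z → pointwise {x * (y + z)} {x * y + x * z}
                       λ n → ℚ.*-distribˡ-+ (proj₁ x n) (proj₁ y n) (proj₁ z n))
                  , (λ x y z → pointwise {(y + z) * x} {y * x + z * x}
                       λ n → ℚ.*-distribʳ-+ (proj₁ x n) (proj₁ y n) (proj₁ z n))
        }
      ; *-comm = λ x y → pointwise {x * y} {y * x} λ n → ℚ.*-comm (proj₁ x n) (proj₁ y n)
      }
    }

-- (a , b) stands for a + b i with i² = -1.

module AdjoinI {c ℓ} (R : CommutativeRing c ℓ) where
  open CommutativeRing R using (Carrier; _≈_; 0#; 1#)
  private
    module R = CommutativeRing R
    open RingProperties R.ring using (-‿distribˡ-*; -‿distribʳ-*; -‿+-comm; -0#≈0#)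
    open CommutativeSemigroupProperties R.+-commutativeSemigroup using (interchange)

  _≈ᶜ_ : Carrier × Carrier → Carrier × Carrier → Set ℓ
  (a , b) ≈ᶜ (a′ , b′) = a ≈ a′ × b ≈ b′

  _+ᶜ_ _*ᶜ_ : Carrier × Carrier → Carrier × Carrier → Carrier × Carrier
  (a , b) +ᶜ (a′ , b′) = a R.+ a′ , b R.+ b′
  (a , b) *ᶜ (a′ , b′) = a R.* a′ R.- b R.* b′ , a R.* b′ R.+ b R.* a′

  -ᶜ_ : Carrier × Carrier → Carrier × Carrier
  -ᶜ (a , b) = R.- a , R.- b

  private
    ≈ᶜ-setoid : Setoid c ℓ
    ≈ᶜ-setoid = record
      { _≈_ = _≈ᶜ_
      ; isEquivalence = record
        { refl = R.refl , R.refl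
        ; sym = λ (p , q) → R.sym p , R.sym q
        ; trans = λ (p , q) (p′ , q′) → R.trans p p′ , R.trans q q′
        }
      }

    open Consequences ≈ᶜ-setoid using (comm∧idˡ⇒id; comm∧distrˡ⇒distrʳ)
    open SetoidReasoning R.setoid

    +ᶜ-cong : ∀ {w x y z} → w ≈ᶜ x → y ≈ᶜ z → (w +ᶜ y) ≈ᶜ (x +ᶜ z)
    +ᶜ-cong (p , q) (p′ , q′) = R.+-cong p p′ , R.+-cong q q′

    *ᶜ-comm : ∀ w z → (w *ᶜ z) ≈ᶜ (z *ᶜ w)
    *ᶜ-comm (a , b) (c , d) =
      R.+-cong (R.*-comm a c) (R.-‿cong (R.*-comm b d)) ,
      R.trans (R.+-comm _ _) (R.+-cong (R.*-comm b c) (R.*-comm a d))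

    *ᶜ-identityˡ : ∀ z → ((1# , 0#) *ᶜ z) ≈ᶜ z
    *ᶜ-identityˡ (a , b) =
      R.trans (R.+-cong (R.*-identityˡ a) (R.trans (R.-‿cong (R.zeroˡ b)) -0#≈0#)) (R.+-identityʳ a) ,
      R.trans (R.+-cong (R.*-identityˡ b) (R.zeroˡ a)) (R.+-identityʳ b)

    *ᶜ-distribˡ-+ᶜ : ∀ x y z → (x *ᶜ (y +ᶜ z)) ≈ᶜ ((x *ᶜ y) +ᶜ (x *ᶜ z))
    *ᶜ-distribˡ-+ᶜ (a , b) (c , d) (e , f) =
      R.trans (R.+-cong (R.distribˡ a c e)
                (R.trans (R.-‿cong (R.distribˡ b d f)) (R.sym (-‿+-comm _ _))))
              (interchange _ _ _ _) ,
      R.trans (R.+-cong (R.distribˡ a d f) (R.distribˡ b c e)) (interchange _ _ _ _)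

    *-distribˡ-- : ∀ x y z → x R.* (y R.- z) ≈ x R.* y R.- x R.* z
    *-distribˡ-- x y z = R.trans (R.distribˡ x y (R.- z)) (R.+-congˡ (R.sym (-‿distribʳ-* x z)))

    *-distribʳ-- : ∀ x y z → (y R.- z) R.* x ≈ y R.* x R.- z R.* x
    *-distribʳ-- x y z = R.trans (R.distribʳ x y (R.- z)) (R.+-congˡ (R.sym (-‿distribˡ-* z x)))

    reorder : ∀ w x y z → (w R.+ x) R.+ (y R.+ z) ≈ (w R.+ y) R.+ (z R.+ x)
    reorder w x y z = R.trans (interchange w x y z) (R.+-congˡ (R.+-comm x z))

    *ᶜ-assoc : ∀ x y z → ((x *ᶜ y) *ᶜ z) ≈ᶜ (x *ᶜ (y *ᶜ z))
    *ᶜ-assoc (a , b) (c , d) (e , f) = (begin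
      (a R.* c R.- b R.* d) R.* e R.- (a R.* d R.+ b R.* c) R.* f
        ≈⟨ R.+-cong (*-distribʳ-- e (a R.* c) (b R.* d))
             (R.trans (R.-‿cong (R.distribʳ f (a R.* d) (b R.* c))) (R.sym (-‿+-comm _ _))) ⟩
      (a R.* c R.* e R.- b R.* d R.* e) R.+ (R.- (a R.* d R.* f) R.- b R.* c R.* f)
        ≈⟨ reorder _ _ _ _ ⟩
      (a R.* c R.* e R.- a R.* d R.* f) R.+ (R.- (b R.* c R.* f) R.- b R.* d R.* e)
        ≈⟨ R.+-cong (R.+-cong (R.*-assoc a c e) (R.-‿cong (R.*-assoc a d f)))
             (R.+-cong (R.-‿cong (R.*-assoc b c f)) (R.-‿cong (R.*-assoc b d e))) ⟩
      (a R.* (c R.* e) R.- a R.* (d R.* f)) R.+ (R.- (b R.* (c R.* f)) R.- b R.* (d R.* e))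
        ≈⟨ R.+-cong (*-distribˡ-- a (c R.* e) (d R.* f))
             (R.trans (R.-‿cong (R.distribˡ b (c R.* f) (d R.* e))) (R.sym (-‿+-comm _ _))) ⟨
      a R.* (c R.* e R.- d R.* f) R.- b R.* (c R.* f R.+ d R.* e) ∎) , (begin
      (a R.* c R.- b R.* d) R.* f R.+ (a R.* d R.+ b R.* c) R.* e
        ≈⟨ R.+-cong (*-distribʳ-- f (a R.* c) (b R.* d)) (R.distribʳ e (a R.* d) (b R.* c)) ⟩
      (a R.* c R.* f R.- b R.* d R.* f) R.+ (a R.* d R.* e R.+ b R.* c R.* e)
        ≈⟨ reorder _ _ _ _ ⟩
      (a R.* c R.* f R.+ a R.* d R.* e) R.+ (b R.* c R.* e R.- b R.* d R.* f)
        ≈⟨ R.+-cong (R.+-cong (R.*-assoc a c f) (R.*-assoc a d e))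
             (R.+-cong (R.*-assoc b c e) (R.-‿cong (R.*-assoc b d f))) ⟩
      (a R.* (c R.* f) R.+ a R.* (d R.* e)) R.+ (b R.* (c R.* e) R.- b R.* (d R.* f))
        ≈⟨ R.+-cong (R.distribˡ a (c R.* f) (d R.* e)) (*-distribˡ-- b (c R.* e) (d R.* f)) ⟨
      a R.* (c R.* f R.+ d R.* e) R.+ b R.* (c R.* e R.- d R.* f) ∎)

  adjoinI : CommutativeRing c ℓ
  adjoinI = record
    { Carrier = Carrier × Carrier ; _≈_ = _≈ᶜ_ ; _+_ = _+ᶜ_ ; _*_ = _*ᶜ_ ; -_ = -ᶜ_
    ; 0# = 0# , 0# ; 1# = 1# , 0#
    ; isCommutativeRing = record
      { isRing = record
        { +-isAbelianGroup = record
          { isGroup = record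
            { isMonoid = record
              { isSemigroup = record
                { isMagma = record
                  { isEquivalence = Setoid.isEquivalence ≈ᶜ-setoid
                  ; ∙-cong = +ᶜ-cong
                  }
                ; assoc = λ _ _ _ → R.+-assoc _ _ _ , R.+-assoc _ _ _
                }
              ; identity = (λ _ → R.+-identityˡ _ , R.+-identityˡ _)
                         , (λ _ → R.+-identityʳ _ , R.+-identityʳ _)
              }
            ; inverse = (λ _ → R.-‿inverseˡ _ , R.-‿inverseˡ _)
                      , (λ _ → R.-‿inverseʳ _ , R.-‿inverseʳ _)
            ; ⁻¹-cong = λ (p , q) → R.-‿cong p , R.-‿cong q
            }
          ; comm = λ _ _ → R.+-comm _ _ , R.+-comm _ _
          }
        ; *-cong = λ (p , q) (p′ , q′) →
            R.+-cong (R.*-cong p p′) (R.-‿cong (R.*-cong q q′)) ,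
            R.+-cong (R.*-cong p q′) (R.*-cong q p′)
        ; *-assoc = *ᶜ-assoc
        ; *-identity = comm∧idˡ⇒id *ᶜ-comm *ᶜ-identityˡ
        ; distrib = *ᶜ-distribˡ-+ᶜ , comm∧distrˡ⇒distrʳ +ᶜ-cong *ᶜ-comm *ᶜ-distribˡ-+ᶜ
        }
      ; *-comm = *ᶜ-comm
      }
    }

ℂ : CommutativeRing 0ℓ 0ℓ
ℂ = AdjoinI.adjoinI Real.ℝ-commutativeRing

private
  variable
    a : Level
    A : Set a

-- Each map into the list occurs exactly once when the list has no repetitions.
functions : ∀ n → List A → List (Vector A n)
functions zero    xs = List.[ Vector.[] ]
functions (suc n) xs = cartesianProductWith Vector._∷_ xs (functions n xs)

bijective? : ∀ {n} (f : Fin n → Fin n) → Dec (Bijective _≡_ _≡_ f)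
bijective? f = injective? ×-dec surjective?
  where
  injective? : Dec (Injective _≡_ _≡_ f)
  injective? = map′ (λ h {x} {y} → h x y) (λ h x y → h)
    (all? λ x → all? λ y → (f x ≟ f y) →-dec (x ≟ y))

  surjective? : Dec (Surjective _≡_ _≡_ f)
  surjective? = map′
    (λ h y → proj₁ (h y) , λ z≡x → ≡.trans (≡.cong f z≡x) (proj₂ (h y)))
    (λ h y → proj₁ (h y) , proj₂ (h y) refl)
    (all? λ y → any? λ x → f x ≟ y)

S : ∀ n → List (Fin n → Fin n)
S n = filter bijective? (functions n (allFin n))

open CommutativeMonoidSum Sign.*-commutativeMonoid using () renaming (sum to ∏ˢ)

-- One factor - for every inversion.
sgn : ∀ {n} → (Fin n → Fin n) → Sign
sgn σ = ∏ˢ λ i → ∏ˢ λ j →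
  if does (i <? j ×-dec σ j <? σ i) then Sign.- else Sign.+

compose : ∀ {d n} → Vector (Fin n → Fin n) d → Fin n → Fin n
compose = Vector.foldr (λ σ τ → σ ∘ τ) id

-- [k]^d, with [k] = Fin k.  The codings finToFun and funToFin between
-- Fin (k ^ d) and Cube d k identify the order of Fin (k ^ d) with the
-- lexicographic order on Cube d k, coordinate zero being the most
-- significant.
Cube : ℕ → ℕ → Set
Cube d k = Vector (Fin k) d

-- For C : [k]^(e+1) → [k^e], the values of C on the slice x ℓ ≡ i in
-- lexicographic order.  Inserting the constant coordinate i at position ℓ
-- is a lexicographic-order isomorphism from [k]^e onto that slice.
onSlice : ∀ {e k} → (Cube (suc e) k → Fin (k ^ e)) →
          Fin (suc e) → Fin k → Fin (k ^ e) → Fin (k ^ e)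
onSlice C ℓ i p = C (insertAt (finToFun p) ℓ i)

IsLatin : ∀ {e k} → (Cube (suc e) k → Fin (k ^ e)) → Set
IsLatin C = ∀ ℓ i → Bijective _≡_ _≡_ (onSlice C ℓ i)

isLatin? : ∀ {e k} (C : Cube (suc e) k → Fin (k ^ e)) → Dec (IsLatin C)
isLatin? C = all? λ ℓ → all? λ i → bijective? (onSlice C ℓ i)

cubeMaps : ∀ e k → List (Cube (suc e) k → Fin (k ^ e))
cubeMaps e k = List.map (_∘ funToFin) (functions (k ^ suc e) (allFin (k ^ e)))

sgnLatin : ∀ {e k} → (Cube (suc e) k → Fin (k ^ e)) → Sign
sgnLatin C = ∏ˢ λ ℓ → ∏ˢ λ i → sgn (onSlice C ℓ i)

AT : (d : ℕ) .{{_ : NonZero d}} → ℕ → ℤ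
AT (suc e) k = foldr ℤ._+_ ℤ.0ℤ
  (List.map (λ C → sgnLatin C ◃ 1) (filter isLatin? (cubeMaps e k)))

module MultilinearAlgebra {c ℓ} (R : CommutativeRing c ℓ) where
  open CommutativeRing R hiding (refl; sym; trans)
  private
    module R = CommutativeRing R

  IsLinear : ∀ {m₁ ℓ₁ m₂ ℓ₂} (M : LeftModule ring m₁ ℓ₁) (N : LeftModule ring m₂ ℓ₂) →
             (LeftModule.Carrierᴹ M → LeftModule.Carrierᴹ N) → Set (c ⊔ m₁ ⊔ ℓ₁ ⊔ ℓ₂)
  IsLinear M N = LeftModuleMorphisms.IsLeftModuleHomomorphism
    (LeftModule.rawLeftModule M) (LeftModule.rawLeftModule N)

  IsIsomorphism : ∀ {m₁ ℓ₁ m₂ ℓ₂} (M : LeftModule ring m₁ ℓ₁) (N : LeftModule ring m₂ ℓ₂) →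
                  (LeftModule.Carrierᴹ M → LeftModule.Carrierᴹ N) → Set (c ⊔ m₁ ⊔ m₂ ⊔ ℓ₁ ⊔ ℓ₂)
  IsIsomorphism M N = LeftModuleMorphisms.IsLeftModuleIsomorphism
    (LeftModule.rawLeftModule M) (LeftModule.rawLeftModule N)

  coordinateSpace : ℕ → LeftModule ring c ℓ
  coordinateSpace n = record
    { Carrierᴹ = Vector Carrier n
    ; _≈ᴹ_ = λ x y → ∀ i → x i ≈ y i
    ; _+ᴹ_ = λ x y i → x i + y i
    ; _*ₗ_ = λ a x i → a * x i
    ; 0ᴹ = λ _ → 0#
    ; -ᴹ_ = λ x i → - x i
    ; isLeftModule = record
      { isLeftSemimodule = record
        { +ᴹ-isCommutativeMonoid = record
          { isMonoid = record
            { isSemigroup = record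
              { isMagma = record
                { isEquivalence = record
                  { refl = λ _ → R.refl
                  ; sym = λ p i → R.sym (p i)
                  ; trans = λ p q i → R.trans (p i) (q i)
                  }
                ; ∙-cong = λ p q i → +-cong (p i) (q i)
                }
              ; assoc = λ _ _ _ _ → +-assoc _ _ _
              }
            ; identity = (λ _ _ → +-identityˡ _) , (λ _ _ → +-identityʳ _)
            }
          ; comm = λ _ _ _ → +-comm _ _
          }
        ; isPreleftSemimodule = record
          { *ₗ-cong = λ p q i → *-cong p (q i)
          ; *ₗ-zeroˡ = λ _ _ → zeroˡ _
          ; *ₗ-distribʳ = λ _ _ _ _ → distribʳ _ _ _
          ; *ₗ-identityˡ = λ _ _ → *-identityˡ _
          ; *ₗ-assoc = λ _ _ _ _ → *-assoc _ _ _
          ; *ₗ-zeroʳ = λ _ _ → zeroʳ _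
          ; *ₗ-distribˡ = λ _ _ _ _ → distribˡ _ _ _
          }
        }
      ; -ᴹ‿cong = λ p i → -‿cong (p i)
      ; -ᴹ‿inverse = (λ _ _ → -‿inverseˡ _) , (λ _ _ → -‿inverseʳ _)
      }
    }

  -- The d-th tensor power of M: formal linear combinations of d-tuples,
  -- modulo the module axioms and multilinearity in the d-tuple.
  module TensorPower {m ℓm} (M : LeftModule ring m ℓm) (d : ℕ) where
    private module M = LeftModule M

    infixl 6 _⊕_
    infixr 7 _·_
    infix 4 _≈ᵀ_

    data Tensor : Set (c ⊔ m) where
      ⨂   : Vector M.Carrierᴹ d → Tensor
      𝟎   : Tensor
      _⊕_ : Tensor → Tensor → Tensor
      _·_ : Carrier → Tensor → Tensor

    data _≈ᵀ_ : Tensor → Tensor → Set (c ⊔ ℓ ⊔ m ⊔ ℓm) where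
      ≈-refl  : ∀ {x} → x ≈ᵀ x
      ≈-sym   : ∀ {x y} → x ≈ᵀ y → y ≈ᵀ x
      ≈-trans : ∀ {x y z} → x ≈ᵀ y → y ≈ᵀ z → x ≈ᵀ z
      ⊕-cong  : ∀ {x x′ y y′} → x ≈ᵀ x′ → y ≈ᵀ y′ → x ⊕ y ≈ᵀ x′ ⊕ y′
      ·-cong  : ∀ {a a′ x x′} → a ≈ a′ → x ≈ᵀ x′ → a · x ≈ᵀ a′ · x′
      ⨂-cong  : ∀ {v w} → (∀ l → v l M.≈ᴹ w l) → ⨂ v ≈ᵀ ⨂ w

      ⊕-assoc     : ∀ x y z → (x ⊕ y) ⊕ z ≈ᵀ x ⊕ (y ⊕ z)
      ⊕-comm      : ∀ x y → x ⊕ y ≈ᵀ y ⊕ x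
      ⊕-identityˡ : ∀ x → 𝟎 ⊕ x ≈ᵀ x
      ·-zeroˡ     : ∀ x → 0# · x ≈ᵀ 𝟎
      ·-zeroʳ     : ∀ a → a · 𝟎 ≈ᵀ 𝟎
      ·-identityˡ : ∀ x → 1# · x ≈ᵀ x
      ·-assoc     : ∀ a b x → (a * b) · x ≈ᵀ a · (b · x)
      ·-distribʳ  : ∀ x a b → (a + b) · x ≈ᵀ a · x ⊕ b · x
      ·-distribˡ  : ∀ a x y → a · (x ⊕ y) ≈ᵀ a · x ⊕ a · y

      ⨂-+ : ∀ v l x y → ⨂ (updateAt v l (const (x M.+ᴹ y))) ≈ᵀ
                        ⨂ (updateAt v l (const x)) ⊕ ⨂ (updateAt v l (const y))
      ⨂-* : ∀ v l a x → ⨂ (updateAt v l (const (a M.*ₗ x))) ≈ᵀ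
                        a · ⨂ (updateAt v l (const x))

    private
      inverseˡ : ∀ x → (- 1# · x) ⊕ x ≈ᵀ 𝟎
      inverseˡ x = ≈-trans (⊕-cong ≈-refl (≈-sym (·-identityˡ x)))
        (≈-trans (≈-sym (·-distribʳ x (- 1#) 1#))
        (≈-trans (·-cong (-‿inverseˡ 1#) ≈-refl) (·-zeroˡ x)))

    tensorPower : LeftModule ring (c ⊔ m) (c ⊔ ℓ ⊔ m ⊔ ℓm)
    tensorPower = record
      { Carrierᴹ = Tensor ; _≈ᴹ_ = _≈ᵀ_ ; _+ᴹ_ = _⊕_ ; _*ₗ_ = _·_
      ; 0ᴹ = 𝟎 ; -ᴹ_ = λ x → - 1# · x
      ; isLeftModule = record
        { isLeftSemimodule = record
          { +ᴹ-isCommutativeMonoid = record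
            { isMonoid = record
              { isSemigroup = record
                { isMagma = record
                  { isEquivalence = record { refl = ≈-refl ; sym = ≈-sym ; trans = ≈-trans }
                  ; ∙-cong = ⊕-cong
                  }
                ; assoc = ⊕-assoc
                }
              ; identity = ⊕-identityˡ , λ x → ≈-trans (⊕-comm x 𝟎) (⊕-identityˡ x)
              }
            ; comm = ⊕-comm
            }
          ; isPreleftSemimodule = record
            { *ₗ-cong = ·-cong
            ; *ₗ-zeroˡ = ·-zeroˡ
            ; *ₗ-distribʳ = ·-distribʳ
            ; *ₗ-identityˡ = ·-identityˡ
            ; *ₗ-assoc = ·-assoc
            ; *ₗ-zeroʳ = ·-zeroʳ
            ; *ₗ-distribˡ = ·-distribˡ
            }
          }
        ; -ᴹ‿cong = ·-cong R.refl
        ; -ᴹ‿inverse = inverseˡ , λ x → ≈-trans (⊕-comm x (- 1# · x)) (inverseˡ x)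
        }
      }

  module _ {m ℓm} (M : LeftModule ring m ℓm) {d : ℕ} where
    private
      module M = LeftModule M
    open TensorPower M d

    mapTensor : (Fin d → M.Carrierᴹ → M.Carrierᴹ) → Tensor → Tensor
    mapTensor f (⨂ v)   = ⨂ (λ l → f l (v l))
    mapTensor f 𝟎       = 𝟎
    mapTensor f (x ⊕ y) = mapTensor f x ⊕ mapTensor f y
    mapTensor f (a · x) = a · mapTensor f x

    mapTensor-isLinear : ∀ {f} → (∀ l → IsLinear M M (f l)) →
                         IsLinear tensorPower tensorPower (mapTensor f)
    mapTensor-isLinear {f} lin = record
      { +ᴹ-isGroupHomomorphism = record
        { isMonoidHomomorphism = record
          { isMagmaHomomorphism = record
            { isRelHomomorphism = record { cong = cong }
            ; homo = λ _ _ → ≈-refl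
            }
          ; ε-homo = ≈-refl
          }
        ; ⁻¹-homo = λ _ → ≈-refl
        }
      ; *ₗ-homo = λ _ _ → ≈-refl
      }
      where
      module F l = LeftModuleMorphisms.IsLeftModuleHomomorphism (lin l)

      pull : ∀ {n} (g : Fin n → M.Carrierᴹ → M.Carrierᴹ) (v : Vector M.Carrierᴹ n) l x z →
             g l x M.≈ᴹ z → ∀ j →
             g j (updateAt v l (const x) j) M.≈ᴹ
             updateAt (λ i → g i (v i)) l (const z) j
      pull g v zero    x z eq zero    = eq
      pull g v zero    x z eq (suc j) = M.≈ᴹ-refl
      pull g v (suc l) x z eq zero    = M.≈ᴹ-refl
      pull g v (suc l) x z eq (suc j) = pull (g ∘ suc) (v ∘ suc) l x z eq j

      cong : ∀ {x y} → x ≈ᵀ y → mapTensor f x ≈ᵀ mapTensor f y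
      cong ≈-refl = ≈-refl
      cong (≈-sym p) = ≈-sym (cong p)
      cong (≈-trans p q) = ≈-trans (cong p) (cong q)
      cong (⊕-cong p q) = ⊕-cong (cong p) (cong q)
      cong (·-cong p q) = ·-cong p (cong q)
      cong (⨂-cong p) = ⨂-cong (λ l → F.⟦⟧-cong l (p l))
      cong (⊕-assoc x y z) = ⊕-assoc _ _ _
      cong (⊕-comm x y) = ⊕-comm _ _
      cong (⊕-identityˡ x) = ⊕-identityˡ _
      cong (·-zeroˡ x) = ·-zeroˡ _
      cong (·-zeroʳ a) = ·-zeroʳ a
      cong (·-identityˡ x) = ·-identityˡ _
      cong (·-assoc a b x) = ·-assoc a b _
      cong (·-distribʳ x a b) = ·-distribʳ _ a b
      cong (·-distribˡ a x y) = ·-distribˡ a _ _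
      cong (⨂-+ v l x y) =
        ≈-trans (⨂-cong (pull f v l (x M.+ᴹ y) _ (F.+ᴹ-homo l x y)))
        (≈-trans (⨂-+ _ l (f l x) (f l y))
          (⊕-cong (≈-sym (⨂-cong (pull f v l x _ M.≈ᴹ-refl)))
                  (≈-sym (⨂-cong (pull f v l y _ M.≈ᴹ-refl)))))
      cong (⨂-* v l a x) =
        ≈-trans (⨂-cong (pull f v l (a M.*ₗ x) _ (F.*ₗ-homo l a x)))
        (≈-trans (⨂-* _ l a (f l x))
          (·-cong R.refl (≈-sym (⨂-cong (pull f v l x _ M.≈ᴹ-refl)))))

  -- ⋀ M: the free associative unital R-algebra on M, modulo linearity of ι
  -- and ι v ∧ ι v ≈ 0.  Scalars enter through the structure map R → ⋀ M.
  module ExteriorAlgebra {m ℓm} (M : LeftModule ring m ℓm) where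
    private module M = LeftModule M

    infixl 6 _⊕_
    infixr 7 _∧_
    infix 4 _≈^_

    data ⋀ : Set (c ⊔ m) where
      scalar : Carrier → ⋀
      ι      : M.Carrierᴹ → ⋀
      _⊕_    : ⋀ → ⋀ → ⋀
      _∧_    : ⋀ → ⋀ → ⋀

    data _≈^_ : ⋀ → ⋀ → Set (c ⊔ ℓ ⊔ m ⊔ ℓm) where
      ≈-refl      : ∀ {x} → x ≈^ x
      ≈-sym       : ∀ {x y} → x ≈^ y → y ≈^ x
      ≈-trans     : ∀ {x y z} → x ≈^ y → y ≈^ z → x ≈^ z
      ⊕-cong      : ∀ {x x′ y y′} → x ≈^ x′ → y ≈^ y′ → x ⊕ y ≈^ x′ ⊕ y′
      ∧-cong      : ∀ {x x′ y y′} → x ≈^ x′ → y ≈^ y′ → x ∧ y ≈^ x′ ∧ y′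
      scalar-cong : ∀ {a b} → a ≈ b → scalar a ≈^ scalar b
      ι-cong      : ∀ {v w} → v M.≈ᴹ w → ι v ≈^ ι w

      ⊕-assoc     : ∀ x y z → (x ⊕ y) ⊕ z ≈^ x ⊕ (y ⊕ z)
      ⊕-comm      : ∀ x y → x ⊕ y ≈^ y ⊕ x
      ⊕-identityˡ : ∀ x → scalar 0# ⊕ x ≈^ x
      ∧-assoc     : ∀ x y z → (x ∧ y) ∧ z ≈^ x ∧ (y ∧ z)
      ∧-identityˡ : ∀ x → scalar 1# ∧ x ≈^ x
      ∧-zeroˡ     : ∀ x → scalar 0# ∧ x ≈^ scalar 0#
      ∧-distribˡ  : ∀ x y z → x ∧ (y ⊕ z) ≈^ (x ∧ y) ⊕ (x ∧ z)
      ∧-distribʳ  : ∀ x y z → (y ⊕ z) ∧ x ≈^ (y ∧ x) ⊕ (z ∧ x)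

      scalar-+       : ∀ a b → scalar (a + b) ≈^ scalar a ⊕ scalar b
      scalar-*       : ∀ a b → scalar (a * b) ≈^ scalar a ∧ scalar b
      scalar-central : ∀ a x → scalar a ∧ x ≈^ x ∧ scalar a

      ι-+       : ∀ v w → ι (v M.+ᴹ w) ≈^ ι v ⊕ ι w
      ι-*       : ∀ a v → ι (a M.*ₗ v) ≈^ scalar a ∧ ι v
      ι-squares : ∀ v → ι v ∧ ι v ≈^ scalar 0#

    private
      inverseˡ : ∀ x → (scalar (- 1#) ∧ x) ⊕ x ≈^ scalar 0#
      inverseˡ x = ≈-trans (⊕-cong ≈-refl (≈-sym (∧-identityˡ x)))
        (≈-trans (≈-sym (∧-distribʳ x (scalar (- 1#)) (scalar 1#)))
        (≈-trans (∧-cong (≈-trans (≈-sym (scalar-+ (- 1#) 1#)) (scalar-cong (-‿inverseˡ 1#))) ≈-refl)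
        (∧-zeroˡ x)))

      ∧-identityʳ : ∀ x → x ∧ scalar 1# ≈^ x
      ∧-identityʳ x = ≈-trans (≈-sym (scalar-central 1# x)) (∧-identityˡ x)

    ⋀-ring : Ring (c ⊔ m) (c ⊔ ℓ ⊔ m ⊔ ℓm)
    ⋀-ring = record
      { Carrier = ⋀ ; _≈_ = _≈^_ ; _+_ = _⊕_ ; _*_ = _∧_ ; -_ = λ x → scalar (- 1#) ∧ x
      ; 0# = scalar 0# ; 1# = scalar 1#
      ; isRing = record
        { +-isAbelianGroup = record
          { isGroup = record
            { isMonoid = record
              { isSemigroup = record
                { isMagma = record
                  { isEquivalence = record { refl = ≈-refl ; sym = ≈-sym ; trans = ≈-trans }
                  ; ∙-cong = ⊕-cong
                  }
                ; assoc = ⊕-assoc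
                }
              ; identity = ⊕-identityˡ , λ x → ≈-trans (⊕-comm x _) (⊕-identityˡ x)
              }
            ; inverse = inverseˡ , λ x → ≈-trans (⊕-comm x _) (inverseˡ x)
            ; ⁻¹-cong = ∧-cong ≈-refl
            }
          ; comm = ⊕-comm
          }
        ; *-cong = ∧-cong
        ; *-assoc = ∧-assoc
        ; *-identity = ∧-identityˡ , ∧-identityʳ
        ; distrib = ∧-distribˡ , ∧-distribʳ
        }
      }

    ⋀-module : LeftModule ring (c ⊔ m) (c ⊔ ℓ ⊔ m ⊔ ℓm)
    ⋀-module = record
      { Carrierᴹ = ⋀ ; _≈ᴹ_ = _≈^_ ; _+ᴹ_ = _⊕_ ; _*ₗ_ = λ a x → scalar a ∧ x
      ; 0ᴹ = scalar 0# ; -ᴹ_ = λ x → scalar (- 1#) ∧ x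
      ; isLeftModule = record
        { isLeftSemimodule = record
          { +ᴹ-isCommutativeMonoid = Ring.+-isCommutativeMonoid ⋀-ring
          ; isPreleftSemimodule = record
            { *ₗ-cong = λ p → ∧-cong (scalar-cong p)
            ; *ₗ-zeroˡ = ∧-zeroˡ
            ; *ₗ-distribʳ = λ x a b → ≈-trans (∧-cong (scalar-+ a b) ≈-refl) (∧-distribʳ x _ _)
            ; *ₗ-identityˡ = ∧-identityˡ
            ; *ₗ-assoc = λ a b x → ≈-trans (∧-cong (scalar-* a b) ≈-refl) (∧-assoc _ _ x)
            ; *ₗ-zeroʳ = λ a → ≈-trans (scalar-central a _) (∧-zeroˡ _)
            ; *ₗ-distribˡ = λ a → ∧-distribˡ (scalar a)
            }
          }
        ; -ᴹ‿cong = ∧-cong ≈-refl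
        ; -ᴹ‿inverse = Ring.-‿inverse ⋀-ring
        }
      }

  module _ {m ℓm} (M : LeftModule ring m ℓm) where
    private module M = LeftModule M
    open ExteriorAlgebra M

    map⋀ : (M.Carrierᴹ → M.Carrierᴹ) → ⋀ → ⋀
    map⋀ f (scalar a) = scalar a
    map⋀ f (ι v)      = ι (f v)
    map⋀ f (x ⊕ y)    = map⋀ f x ⊕ map⋀ f y
    map⋀ f (x ∧ y)    = map⋀ f x ∧ map⋀ f y

    map⋀-cong : ∀ {f} → IsLinear M M f → ∀ {x y} → x ≈^ y → map⋀ f x ≈^ map⋀ f y
    map⋀-cong {f} lin = cong
      where
      module F = LeftModuleMorphisms.IsLeftModuleHomomorphism lin

      cong : ∀ {x y} → x ≈^ y → map⋀ f x ≈^ map⋀ f y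
      cong ≈-refl = ≈-refl
      cong (≈-sym p) = ≈-sym (cong p)
      cong (≈-trans p q) = ≈-trans (cong p) (cong q)
      cong (⊕-cong p q) = ⊕-cong (cong p) (cong q)
      cong (∧-cong p q) = ∧-cong (cong p) (cong q)
      cong (scalar-cong p) = scalar-cong p
      cong (ι-cong p) = ι-cong (F.⟦⟧-cong p)
      cong (⊕-assoc x y z) = ⊕-assoc _ _ _
      cong (⊕-comm x y) = ⊕-comm _ _
      cong (⊕-identityˡ x) = ⊕-identityˡ _
      cong (∧-assoc x y z) = ∧-assoc _ _ _
      cong (∧-identityˡ x) = ∧-identityˡ _
      cong (∧-zeroˡ x) = ∧-zeroˡ _
      cong (∧-distribˡ x y z) = ∧-distribˡ _ _ _
      cong (∧-distribʳ x y z) = ∧-distribʳ _ _ _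
      cong (scalar-+ a b) = scalar-+ a b
      cong (scalar-* a b) = scalar-* a b
      cong (scalar-central a x) = scalar-central a _
      cong (ι-+ v w) = ≈-trans (ι-cong (F.+ᴹ-homo v w)) (ι-+ _ _)
      cong (ι-* a v) = ≈-trans (ι-cong (F.*ₗ-homo a v)) (ι-* a _)
      cong (ι-squares v) = ι-squares _

module Representation {c ℓ} (R : CommutativeRing c ℓ) (d k : ℕ) where
  open CommutativeRing R hiding (refl; sym; trans)
  open MultilinearAlgebra R
  open SemiringExp semiring using () renaming (_^_ to _^ᴿ_)
  open SemiringSum semiring using (sum; sum-cong-≋; ∑-distrib-+; *-distribˡ-sum)
  open CommutativeMonoidSum *-commutativeMonoid using () renaming (sum to ∏)
  private
    module R = CommutativeRing R
    open RingProperties ring using (-1*x≈-x)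

  V : LeftModule ring c (c ⊔ ℓ)
  V = TensorPower.tensorPower (coordinateSpace k) d

  open TensorPower (coordinateSpace k) d using (⨂)
  open ExteriorAlgebra V public

  Matrix : Set c
  Matrix = Fin k → Fin k → Carrier

  mulVec : Matrix → Vector Carrier k → Vector Carrier k
  mulVec g v i = sum λ j → g i j * v j

  mulVec-isLinear : ∀ g → IsLinear (coordinateSpace k) (coordinateSpace k) (mulVec g)
  mulVec-isLinear g = record
    { +ᴹ-isGroupHomomorphism = record
      { isMonoidHomomorphism = record
        { isMagmaHomomorphism = record
          { isRelHomomorphism = record { cong = cong }
          ; homo = λ v w i → R.trans (sum-cong-≋ λ j → distribˡ (g i j) (v j) (w j))
              (∑-distrib-+ (λ j → g i j * v j) (λ j → g i j * w j))
          }
        ; ε-homo = λ i → R.trans (R.trans (sum-cong-≋ λ j → R.trans (zeroʳ (g i j)) (R.sym (zeroˡ 0#)))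
            (R.sym (*-distribˡ-sum 0# (λ (_ : Fin k) → 0#)))) (zeroˡ _)
        }
      ; ⁻¹-homo = λ v i → R.trans (cong (λ j → R.sym (-1*x≈-x (v j))) i)
          (R.trans (homo (- 1#) v i) (-1*x≈-x _))
      }
    ; *ₗ-homo = homo
    }
    where
    cong : ∀ {v w} → (∀ i → v i ≈ w i) → ∀ i → mulVec g v i ≈ mulVec g w i
    cong p i = sum-cong-≋ λ j → *-congˡ (p j)

    homo : ∀ a v i → mulVec g (λ j → a * v j) i ≈ a * mulVec g v i
    homo a v i = R.trans
      (sum-cong-≋ λ j → R.trans (R.sym (*-assoc (g i j) a (v j)))
        (R.trans (*-congʳ (*-comm (g i j) a)) (*-assoc a (g i j) (v j))))
      (R.sym (*-distribˡ-sum a (λ j → g i j * v j)))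

  -- Defined for arbitrary d-tuples of matrices; weights and highest weight
  -- vectors only involve invertible diagonal and unitriangular ones.
  act : (Fin d → Matrix) → ⋀ → ⋀
  act g = map⋀ V (mapTensor (coordinateSpace k) λ l → mulVec (g l))

  act-cong : ∀ g {x y} → x ≈^ y → act g x ≈^ act g y
  act-cong g = map⋀-cong V (mapTensor-isLinear (coordinateSpace k) λ l → mulVec-isLinear (g l))

  record Unit : Set (c ⊔ ℓ) where
    field
      value   : Carrier
      inverse : Carrier
      isUnit  : value * inverse ≈ 1#

  _^ᶻ_ : Unit → ℤ → Carrier
  u ^ᶻ (ℤ.+ n)  = Unit.value u ^ᴿ n
  u ^ᶻ -[1+ n ] = Unit.inverse u ^ᴿ suc n

  diag : (Fin k → Unit) → Matrix
  diag t i j = if does (i ≟ j) then Unit.value (t i) else 0#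

  IsUpperUnitriangular : Matrix → Set ℓ
  IsUpperUnitriangular u = (∀ i → u i i ≈ 1#) × (∀ i j → j < i → u i j ≈ 0#)

  Weight : Set
  Weight = Fin d → Fin k → ℤ

  character : Weight → (Fin d → Fin k → Unit) → Carrier
  character μ t = ∏ λ l → ∏ λ i → t l i ^ᶻ μ l i

  -- Both conditions hold for 0, so no separate clause for it is needed.
  record IsHWV (μ : Weight) (v : ⋀) : Set (c ⊔ ℓ) where
    field
      weight    : ∀ t → act (λ l → diag (t l)) v ≈^ scalar (character μ t) ∧ v
      invariant : ∀ u → (∀ l → IsUpperUnitriangular (u l)) → act u v ≈^ v

  HWV : Weight → LeftModule ring (c ⊔ ℓ) (c ⊔ ℓ)
  HWV μ = record
    { Carrierᴹ = ∃ (IsHWV μ)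
    ; _≈ᴹ_ = λ x y → proj₁ x ≈^ proj₁ y
    ; _+ᴹ_ = λ (x , p) (y , q) → x ⊕ y , ⊕-closed p q
    ; _*ₗ_ = λ a (x , p) → scalar a ∧ x , scalar-closed a p
    ; 0ᴹ = scalar 0# , record
      { weight = λ t → ≈-sym (≈-trans (scalar-central _ _) (∧-zeroˡ _))
      ; invariant = λ _ _ → ≈-refl
      }
    ; -ᴹ_ = λ (x , p) → scalar (- 1#) ∧ x , scalar-closed (- 1#) p
    ; isLeftModule = record
      { isLeftSemimodule = record
        { +ᴹ-isCommutativeMonoid = record
          { isMonoid = record
            { isSemigroup = record
              { isMagma = record
                { isEquivalence = record { refl = ≈-refl ; sym = ≈-sym ; trans = ≈-trans }
                ; ∙-cong = ⊕-cong
                }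
              ; assoc = λ _ _ _ → ⊕-assoc _ _ _
              }
            ; identity = (λ _ → M.+ᴹ-identityˡ _) , (λ _ → M.+ᴹ-identityʳ _)
            }
          ; comm = λ _ _ → ⊕-comm _ _
          }
        ; isPreleftSemimodule = record
          { *ₗ-cong = M.*ₗ-cong
          ; *ₗ-zeroˡ = λ _ → M.*ₗ-zeroˡ _
          ; *ₗ-distribʳ = λ _ _ _ → M.*ₗ-distribʳ _ _ _
          ; *ₗ-identityˡ = λ _ → M.*ₗ-identityˡ _
          ; *ₗ-assoc = λ _ _ _ → M.*ₗ-assoc _ _ _
          ; *ₗ-zeroʳ = λ _ → M.*ₗ-zeroʳ _
          ; *ₗ-distribˡ = λ _ _ _ → M.*ₗ-distribˡ _ _ _
          }
        }
      ; -ᴹ‿cong = M.-ᴹ‿cong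
      ; -ᴹ‿inverse = (λ _ → M.-ᴹ‿inverseˡ _) , (λ _ → M.-ᴹ‿inverseʳ _)
      }
    }
    where
    module M = LeftModule ⋀-module

    ⊕-closed : ∀ {x y} → IsHWV μ x → IsHWV μ y → IsHWV μ (x ⊕ y)
    ⊕-closed p q = record
      { weight = λ t → ≈-trans (⊕-cong (IsHWV.weight p t) (IsHWV.weight q t))
          (≈-sym (∧-distribˡ _ _ _))
      ; invariant = λ u h → ⊕-cong (IsHWV.invariant p u h) (IsHWV.invariant q u h)
      }

    scalar-closed : ∀ a {x} → IsHWV μ x → IsHWV μ (scalar a ∧ x)
    scalar-closed a p = record
      { weight = λ t → ≈-trans (∧-cong ≈-refl (IsHWV.weight p t))
          (≈-trans (≈-sym (∧-assoc _ _ _))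
          (≈-trans (∧-cong (scalar-central a _) ≈-refl) (∧-assoc _ _ _)))
      ; invariant = λ u h → ∧-cong ≈-refl (IsHWV.invariant p u h)
      }

  e : Fin k → Vector Carrier k
  e i j = if does (i ≟ j) then 1# else 0#

  ⟦_⟧ : Sign → Carrier
  ⟦ Sign.+ ⟧ = 1#
  ⟦ Sign.- ⟧ = - 1#

  cayleyTerm : (Fin d → Fin k → Fin k) → ⋀
  cayleyTerm π = scalar ⟦ sgn (compose π) ⟧ ∧
    Vector.foldr _∧_ (scalar 1#) (λ (i : Fin k) → ι (⨂ λ l → e (π l i)))

  cayleyForm : ⋀
  cayleyForm = foldr _⊕_ (scalar 0#) (List.map cayleyTerm (functions d (S k)))

  L : ⋀ → ⋀
  L v = cayleyForm ∧ v

  L^ : ℕ → ⋀ → ⋀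
  L^ m v = fold v L m

  W : ℕ → LeftModule ring (c ⊔ ℓ) (c ⊔ ℓ)
  W n = HWV (λ _ _ → ℤ.+ n)

  -- For all n ∈ [0 , k^(d-1) / 2], L^(k^(d-1) - 2n) restricts to a map
  -- W n → W (k^(d-1) - n), and this restriction is an isomorphism.
  HLP∅ : Set (c ⊔ ℓ)
  HLP∅ = ∀ n → 2 ℕ.* n ℕ.≤ N →
    ∃ λ (f : LeftModule.Carrierᴹ (W n) → LeftModule.Carrierᴹ (W (N ∸ n))) →
      (∀ v → proj₁ (f v) ≈^ L^ (N ∸ 2 ℕ.* n) (proj₁ v)) ×
      IsIsomorphism (W n) (W (N ∸ n)) f
    where
    N : ℕ
    N = k ^ (d ∸ 1)

{-# OPTIONS --safe #-}
module Submission where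

-- HLP for n = 0 says in particular that ω^N ≠ 0, where N = k^(d-1), because
-- W_0 contains 1.  Expanding ω^N gives a sum over N-tuples of d-tuples of
-- permutations of [k]; such a table lists N·k = k^d cells of the cube, and its
-- wedge product vanishes unless every cell is listed once.  Labelling the
-- cells by the index of the factor containing them then defines a Latin
-- hypercube, and each Latin hypercube arises from (k!)^N tables, one for each
-- ordering of the cells of each symbol.  For every direction ℓ, ordering the
-- cells by (symbol, index) and by (coordinate ℓ, symbol) compares the sign of
-- the listing and the signs of the permutations in direction ℓ with the signs
-- of the slices in direction ℓ.  As d is odd, multiplying over all ℓ shows
-- that ω^N is ± (k!)^N AT_d(k) times the wedge product of all basis vectors.

open import Defs
open import Algebra.Bundles using (CommutativeMonoid; CommutativeRing; Monoid; Ring; Semiring)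
open import Algebra.Module.Bundles using (LeftModule)
open import Algebra.Module.Morphism.Structures using (module LeftModuleMorphisms)
import Algebra.Properties.CommutativeMonoid.Sum as CommutativeMonoidSum
import Algebra.Properties.CommutativeSemigroup as CommutativeSemigroupProperties
import Algebra.Properties.Monoid.Sum as MonoidSum
import Algebra.Properties.Ring as RingProperties
import Algebra.Properties.Semiring.Mult as SemiringMult
import Algebra.Solver.CommutativeMonoid as CommutativeMonoidSolver
open import Data.Bool.Base using (Bool; true; false; if_then_else_)
open import Data.Fin.Base using (Fin; zero; suc; _<_; toℕ; combine; remQuot; quotient; punchOut; _↑ˡ_; _↑ʳ_; finToFun; funToFin)
open import Data.Fin.Properties using (_≟_; _<?_; <-cmp; <-irrefl; <-asym; all?; any?; injective⇒≤; punchOut-injective; toℕ-combine; combine-monoˡ-<; combine-injective; combine-remQuot; remQuot-combine; funToFin-finToFin; finToFun-funToFin)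
open import Data.Integer.Base as ℤ using (ℤ; 0ℤ; -[1+_]; _◃_)
open import Data.List.Base as List using (List; []; _∷_; _++_; foldr; tabulate; allFin; filter; cartesianProduct; cartesianProductWith)
open import Data.List.Membership.Propositional using (_∈_)
open import Data.List.Membership.Propositional.Properties using (∈-tabulate⁺; ∈-allFin)
open import Data.List.Membership.Propositional.Properties.WithK using (unique∧set⇒bag)
open import Data.List.Properties using (map-∘)
open import Data.List.Relation.Binary.BagAndSetEquality using (∼bag⇒↭)
open import Data.List.Relation.Binary.Permutation.Propositional as Perm using (_↭_)
open import Data.List.Relation.Unary.All as All using (All; []; _∷_)
import Data.List.Relation.Unary.All.Properties as All
open import Data.List.Relation.Unary.Any using (here; there)
open import Data.List.Relation.Unary.Unique.Propositional.Properties using (tabulate⁺; allFin⁺)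
open import Data.Nat.Base as ℕ using (ℕ; zero; suc; NonZero; _≤_; _^_; z≤n; s<s⁻¹)
open import Data.Nat.Divisibility.Core using (_∣_; _∤_; divides)
open import Data.Nat.GeneralisedArithmetic using (fold)
import Data.Nat.Properties as ℕ
open import Data.Product.Base using (∃; _×_; _,_; proj₁; proj₂; uncurry)
open import Data.Rational.Base using (1ℚ)
import Data.Rational.Properties as ℚ
open import Data.Sign.Base as Sign using (Sign)
import Data.Sign.Properties as Sign
open import Data.Sum.Base using (_⊎_; inj₁; inj₂)
open import Data.Vec.Functional as Vector using (Vector; insertAt; removeAt)
open import Data.Vec.Functional.Properties using (insertAt-removeAt; insertAt-lookup)
open import Function.Base using (_∘_; id; case_of_)
open import Function.Bundles using (_⇔_; mk⇔; mk⤖; module Equivalence)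
open import Function.Definitions using (Injective; Surjective; Bijective)
open import Function.Properties.Bijection using (⤖⇒↔)
open import Level using (Level; _⊔_)
open import Relation.Binary.Definitions using (tri<; tri≈; tri>)
open import Relation.Binary.PropositionalEquality using (_≡_; _≢_; _≗_; refl; sym; trans; cong; cong₂; subst; module ≡-Reasoning)
import Relation.Binary.Reasoning.Setoid as SetoidReasoning
open import Relation.Nullary using (¬_)
open import Relation.Nullary.Decidable using (Dec; yes; no; does; _×-dec_; dec-true; dec-false; does-⇔)
open import Relation.Nullary.Negation using (contradiction)
open import Relation.Unary using (Decidable)


-- Bijections of finite sets and products of signs

open CommutativeMonoidSum Sign.*-commutativeMonoid
  renaming (sum to ∏ˢ; sum-cong-≗ to ∏ˢ-cong; ∑-distrib-+ to ∏ˢ-distrib-*; ∑-comm to ∏ˢ-comm; sum-permute to ∏ˢ-permute)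
  using ()

-- If some `y` were missed, punching it out would inject `Fin (suc n)` into `Fin n`. The sizes are
-- only propositionally equal so that this also covers `k ^ e * k` and `k ^ suc e`.
injective⇒surjective : ∀ {m n} {f : Fin m → Fin n} → m ≡ n → Injective _≡_ _≡_ f → Surjective _≡_ _≡_ f
injective⇒surjective {n = suc n} {f} refl inj y with any? (λ x → f x ≟ y)
... | yes (x , fx≡y) = x , λ { refl → fx≡y }
... | no ¬hit = contradiction
  (injective⇒≤ {f = λ x → punchOut (y≢f x)} λ eq → inj (punchOut-injective (y≢f _) (y≢f _) eq))
  ℕ.1+n≰n
  where
  y≢f : ∀ x → y ≢ f x
  y≢f x y≡fx = ¬hit (x , sym y≡fx)

injective⇒bijective : ∀ {m n} {f : Fin m → Fin n} → m ≡ n → Injective _≡_ _≡_ f → Bijective _≡_ _≡_ f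
injective⇒bijective m≡n inj = inj , injective⇒surjective m≡n inj

-- A section of `f` is injective, hence surjective by counting, so it is a two-sided inverse.
surjective⇒bijective : ∀ {m n} {f : Fin m → Fin n} → m ≡ n → (∀ y → ∃ λ x → f x ≡ y) → Bijective _≡_ _≡_ f
surjective⇒bijective {f = f} m≡n sur = inj , λ y → proj₁ (sur y) , λ { refl → proj₂ (sur y) }
  where
  g = proj₁ ∘ sur
  fg : ∀ y → f (g y) ≡ y
  fg = proj₂ ∘ sur
  g-inj : Injective _≡_ _≡_ g
  g-inj {y} {z} eq = trans (sym (fg y)) (trans (cong f eq) (fg z))
  g-sur = injective⇒surjective (sym m≡n) g-inj
  gf : ∀ x → g (f x) ≡ x
  gf x with y , eq ← g-sur x = trans (cong (g ∘ f) (sym (eq refl))) (trans (cong g (fg y)) (eq refl))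
  inj : Injective _≡_ _≡_ f
  inj {x} {z} eq = trans (sym (gf x)) (trans (cong g eq) (gf z))

∘-bijective : ∀ {l m n} {f : Fin m → Fin n} {g : Fin l → Fin m} →
  Bijective _≡_ _≡_ f → Bijective _≡_ _≡_ g → Bijective _≡_ _≡_ (f ∘ g)
∘-bijective {f = f} (fi , fs) (gi , gs) = (gi ∘ fi) , λ y →
  let x , eq = fs y ; w , eq′ = gs x in w , λ { refl → eq (eq′ refl) }

module SumLemmas {c ℓ} (M : Monoid c ℓ) where
  open Monoid M renaming (refl to ≈-refl; sym to ≈-sym; trans to ≈-trans)
  open MonoidSum M

  sum-only : ∀ {n} (f : Fin n → Carrier) i → (∀ j → j ≢ i → f j ≈ ε) → sum f ≈ f i
  sum-only {suc n} f zero    h = ≈-trans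
    (∙-congˡ (≈-trans (sum-cong-≋ λ j → h (suc j) λ ()) (sum-replicate-zero n))) (identityʳ _)
  sum-only {suc n} f (suc i) h = ≈-trans
    (∙-cong (h zero λ ()) (sum-only (f ∘ suc) i λ j j≢i → h (suc j) λ { refl → j≢i refl })) (identityˡ _)

  sum-↑ : ∀ m {n} (f : Fin (m ℕ.+ n) → Carrier) →
          sum f ≈ sum (λ i → f (i ↑ˡ n)) ∙ sum (λ j → f (m ↑ʳ j))
  sum-↑ zero    f = ≈-sym (identityˡ _)
  sum-↑ (suc m) f = ≈-trans (∙-congˡ (sum-↑ m (f ∘ suc))) (≈-sym (assoc _ _ _))

  sum-combine : ∀ m {n} (f : Fin (m ℕ.* n) → Carrier) →
                sum f ≈ sum λ (i : Fin m) → sum λ (j : Fin n) → f (combine i j)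
  sum-combine zero        f = ≈-refl
  sum-combine (suc m) {n} f = ≈-trans (sum-↑ n f) (∙-congˡ (sum-combine m {n} (λ i → f (n ↑ʳ i))))

open SumLemmas Sign.*-monoid
  renaming (sum-only to ∏ˢ-only; sum-combine to ∏ˢ-combine)
  using ()

∏ˢ-bijective : ∀ {m n} (g : Fin n → Sign) {f : Fin m → Fin n} → Bijective _≡_ _≡_ f → ∏ˢ g ≡ ∏ˢ (g ∘ f)
∏ˢ-bijective g bij = ∏ˢ-permute g (⤖⇒↔ (mk⤖ bij))

∏ˢ-+ : ∀ {n} {g : Fin n → Sign} → (∀ i → g i ≡ Sign.+) → ∏ˢ g ≡ Sign.+
∏ˢ-+ {zero}  h = refl
∏ˢ-+ {suc n} h rewrite h zero = ∏ˢ-+ (h ∘ suc)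

-- Signs of maps as parities of inversions

χ : Bool → Sign
χ b = if b then Sign.- else Sign.+

inversion : ∀ {a b} → (Fin a → Fin b) → Fin a → Fin a → Sign
inversion f i j = χ (does (i <? j ×-dec f j <? f i))

-- Extends `sgn` to maps between differently written index sets; on self-maps both unfold to the
-- same double product.
inversionSign : ∀ {a b} → (Fin a → Fin b) → Sign
inversionSign f = ∏ˢ λ i → ∏ˢ λ j → inversion f i j

private
  ∏ˢ² : ∀ {m n} → (Fin m → Fin n → Sign) → Sign
  ∏ˢ² g = ∏ˢ λ i → ∏ˢ λ j → g i j

  ∏ˢ²-cong : ∀ {m n} {g h : Fin m → Fin n → Sign} → (∀ i j → g i j ≡ h i j) → ∏ˢ² g ≡ ∏ˢ² h
  ∏ˢ²-cong eq = ∏ˢ-cong λ i → ∏ˢ-cong (eq i)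

  ∏ˢ²-distrib : ∀ {m n} (g h : Fin m → Fin n → Sign) → ∏ˢ² (λ i j → g i j Sign.* h i j) ≡ ∏ˢ² g Sign.* ∏ˢ² h
  ∏ˢ²-distrib g h = trans (∏ˢ-cong λ i → ∏ˢ-distrib-* (g i) (h i)) (∏ˢ-distrib-* (∏ˢ ∘ g) (∏ˢ ∘ h))

  -- A double product splits into a diagonal, an upper and a lower part; transposing the lower part
  -- leaves one factor per unordered pair. Multiplicativity of signs needs this coarser comparison,
  -- because a map may reverse the order of a pair.
  ∏ˢ²-unordered : ∀ {n} (g h : Fin n → Fin n → Sign) → (∀ i → g i i ≡ h i i) →
    (∀ i j → i < j → g i j Sign.* g j i ≡ h i j Sign.* h j i) → ∏ˢ² g ≡ ∏ˢ² h
  ∏ˢ²-unordered {n} g h diag pairs = trans (decompose g) (trans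
    (cong₂ Sign._*_ (∏ˢ²-cong same-diag) (∏ˢ²-cong same-pairs)) (sym (decompose h)))
    where
    above on below pair : (Fin n → Fin n → Sign) → Fin n → Fin n → Sign
    above g i j = if does (i <? j) then g i j else Sign.+
    below g i j = if does (j <? i) then g i j else Sign.+
    on g i j = if does (i ≟ j) then g i j else Sign.+
    pair g i j = if does (i <? j) then g i j Sign.* g j i else Sign.+

    pointwise : ∀ g i j → g i j ≡ on g i j Sign.* (above g i j Sign.* below g i j)
    pointwise g i j with <-cmp i j
    ... | tri< p q r rewrite dec-true (i <? j) p | dec-false (i ≟ j) q | dec-false (j <? i) r =
      sym (Sign.*-identityʳ _)
    ... | tri≈ p q r rewrite dec-false (i <? j) p | dec-true (i ≟ j) q | dec-false (j <? i) r =
      sym (Sign.*-identityʳ _)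
    ... | tri> p q r rewrite dec-false (i <? j) p | dec-false (i ≟ j) q | dec-true (j <? i) r = refl

    fold-pair : ∀ g i j → above g i j Sign.* below g j i ≡ pair g i j
    fold-pair g i j with does (i <? j)
    ... | true  = refl
    ... | false = refl

    decompose : ∀ g → ∏ˢ² g ≡ ∏ˢ² (on g) Sign.* ∏ˢ² (pair g)
    decompose g = begin
      ∏ˢ² g
        ≡⟨ ∏ˢ²-cong (pointwise g) ⟩
      ∏ˢ² (λ i j → on g i j Sign.* (above g i j Sign.* below g i j))
        ≡⟨ ∏ˢ²-distrib (on g) _ ⟩
      ∏ˢ² (on g) Sign.* ∏ˢ² (λ i j → above g i j Sign.* below g i j)
        ≡⟨ cong (∏ˢ² (on g) Sign.*_) (∏ˢ²-distrib (above g) (below g)) ⟩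
      ∏ˢ² (on g) Sign.* (∏ˢ² (above g) Sign.* ∏ˢ² (below g))
        ≡⟨ cong (λ z → ∏ˢ² (on g) Sign.* (∏ˢ² (above g) Sign.* z)) (∏ˢ-comm (below g)) ⟩
      ∏ˢ² (on g) Sign.* (∏ˢ² (above g) Sign.* ∏ˢ² (λ i j → below g j i))
        ≡⟨ cong (∏ˢ² (on g) Sign.*_) (∏ˢ²-distrib (above g) _) ⟨
      ∏ˢ² (on g) Sign.* ∏ˢ² (λ i j → above g i j Sign.* below g j i)
        ≡⟨ cong (∏ˢ² (on g) Sign.*_) (∏ˢ²-cong (fold-pair g)) ⟩
      ∏ˢ² (on g) Sign.* ∏ˢ² (pair g) ∎
      where open ≡-Reasoning

    same-diag : ∀ i j → on g i j ≡ on h i j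
    same-diag i j with i ≟ j
    ... | yes refl = diag i
    ... | no _     = refl

    same-pairs : ∀ i j → pair g i j ≡ pair h i j
    same-pairs i j with i <? j
    ... | yes i<j rewrite dec-true (i <? j) i<j = pairs i j i<j
    ... | no i≮j rewrite dec-false (i <? j) i≮j = refl


-- On each pair, the composite reverses the order exactly when one of the two maps does and the
-- other does not. Bijectivity of `f` allows the inversions of `κ` to be reindexed by the pairs
-- `(f i , f j)`.
inversionSign-∘ : ∀ {a b c} {f : Fin a → Fin b} {κ : Fin b → Fin c} →
  Bijective _≡_ _≡_ f → Injective _≡_ _≡_ κ →
  inversionSign (κ ∘ f) ≡ inversionSign f Sign.* inversionSign κ
inversionSign-∘ {f = f} {κ} bij κ-inj = begin
  ∏ˢ² (inversion (κ ∘ f))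
    ≡⟨ ∏ˢ²-unordered _ _ diag pairs ⟩
  ∏ˢ² (λ i j → inversion f i j Sign.* inversion κ (f i) (f j))
    ≡⟨ ∏ˢ²-distrib (inversion f) _ ⟩
  inversionSign f Sign.* ∏ˢ² (λ i j → inversion κ (f i) (f j))
    ≡⟨ cong (inversionSign f Sign.*_) (trans (∏ˢ-bijective _ bij) (∏ˢ-cong λ i → ∏ˢ-bijective (inversion κ (f i)) bij)) ⟨
  inversionSign f Sign.* inversionSign κ ∎
  where
  open ≡-Reasoning
  diag : ∀ i → inversion (κ ∘ f) i i ≡ inversion f i i Sign.* inversion κ (f i) (f i)
  diag i rewrite dec-false (i <? i) (<-irrefl refl) | dec-false (f i <? f i) (<-irrefl refl) = refl

  pairs : ∀ i j → i < j → inversion (κ ∘ f) i j Sign.* inversion (κ ∘ f) j i ≡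
    (inversion f i j Sign.* inversion κ (f i) (f j)) Sign.* (inversion f j i Sign.* inversion κ (f j) (f i))
  pairs i j i<j
    rewrite dec-true (i <? j) i<j | dec-false (j <? i) (<-asym i<j)
    with <-cmp (f i) (f j) | <-cmp (κ (f i)) (κ (f j))
  ... | tri≈ _ q _ | _ = contradiction (proj₁ bij q) λ { refl → <-irrefl refl i<j }
  ... | tri< _ _ _ | tri≈ _ q _ = contradiction (proj₁ bij (κ-inj q)) λ { refl → <-irrefl refl i<j }
  ... | tri> _ _ _ | tri≈ _ q _ = contradiction (proj₁ bij (κ-inj q)) λ { refl → <-irrefl refl i<j }
  ... | tri< p _ r | tri< _ _ r′
    rewrite dec-true (f i <? f j) p | dec-false (f j <? f i) r
          | dec-false (κ (f j) <? κ (f i)) r′ = refl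
  ... | tri< p _ r | tri> _ _ r′
    rewrite dec-true (f i <? f j) p | dec-false (f j <? f i) r
          | dec-true (κ (f j) <? κ (f i)) r′ = refl
  -- From here on `f` has already reversed the pair, so the factor of `κ` comes from `(f j , f i)`.
  ... | tri> p _ r | tri< p′ _ r′
    rewrite dec-false (f i <? f j) p | dec-true (f j <? f i) r
          | dec-true (κ (f i) <? κ (f j)) p′ | dec-false (κ (f j) <? κ (f i)) r′ = refl
  ... | tri> p _ r | tri> p′ _ r′
    rewrite dec-false (f i <? f j) p | dec-true (f j <? f i) r
          | dec-false (κ (f i) <? κ (f j)) p′ | dec-true (κ (f j) <? κ (f i)) r′ = refl

inversionSign-cong : ∀ {a b} {f g : Fin a → Fin b} → (∀ i → f i ≡ g i) → inversionSign f ≡ inversionSign g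
inversionSign-cong eq = ∏ˢ²-cong λ i j →
  cong₂ (λ u v → χ (does (i <? j ×-dec v <? u))) (eq i) (eq j)

combine-monoʳ-< : ∀ {m n} (a : Fin m) {p q : Fin n} → p < q → combine a p < combine a q
combine-monoʳ-< {n = n} a {p} {q} p<q rewrite toℕ-combine a p | toℕ-combine a q =
  ℕ.+-monoʳ-< (n ℕ.* toℕ a) p<q

combine-cancelʳ-< : ∀ {m n} (a : Fin m) {p q : Fin n} → combine a p < combine a q → p < q
combine-cancelʳ-< {n = n} a {p} {q} lt rewrite toℕ-combine a p | toℕ-combine a q =
  ℕ.+-cancelˡ-< (n ℕ.* toℕ a) _ _ lt

fibrewise : ∀ {m n} → (Fin m → Fin n → Fin n) → Fin (m ℕ.* n) → Fin (m ℕ.* n)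
fibrewise {n = n} σ z = uncurry (λ a p → combine a (σ a p)) (remQuot n z)

fibrewise-combine : ∀ {m n} (σ : Fin m → Fin n → Fin n) a p →
  fibrewise σ (combine a p) ≡ combine a (σ a p)
fibrewise-combine σ a p = cong (uncurry λ a p → combine a (σ a p)) (remQuot-combine a p)

-- Places in different blocks keep their order, since the block is the leading digit; only
-- inversions within a block remain.
inversionSign-fibrewise : ∀ {m n} (σ : Fin m → Fin n → Fin n) →
  inversionSign (fibrewise σ) ≡ ∏ˢ λ a → sgn (σ a)
inversionSign-fibrewise {m} {n} σ = trans (∏ˢ-combine m {n} _) (∏ˢ-cong λ a → ∏ˢ-cong λ p →
  trans (∏ˢ-combine m {n} _) (trans (∏ˢ-only _ a λ b b≢a → ∏ˢ-+ λ q → different p q (b≢a ∘ sym))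
    (∏ˢ-cong λ q → same a p q)))
  where
  different : ∀ {a b} p q → a ≢ b → inversion (fibrewise σ) (combine a p) (combine b q) ≡ Sign.+
  different {a} {b} p q a≢b
    rewrite fibrewise-combine σ a p | fibrewise-combine σ b q with <-cmp a b
  ... | tri≈ _ a≡b _ = contradiction a≡b a≢b
  ... | tri< a<b _ _ rewrite
      dec-true (combine a p <? combine b q) (combine-monoˡ-< p q a<b)
    | dec-false (combine b (σ b q) <? combine a (σ a p)) (<-asym (combine-monoˡ-< (σ a p) (σ b q) a<b)) = refl
  ... | tri> _ _ b<a rewrite
      dec-false (combine a p <? combine b q) (<-asym (combine-monoˡ-< q p b<a)) = refl

  same : ∀ a p q → inversion (fibrewise σ) (combine a p) (combine a q) ≡ inversion (σ a) p q
  same a p q rewrite fibrewise-combine σ a p | fibrewise-combine σ a q = cong χ (does-⇔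
    (mk⇔ (λ (u , v) → combine-cancelʳ-< a u , combine-cancelʳ-< a v)
         (λ (u , v) → combine-monoʳ-< a u , combine-monoʳ-< a v))
    (combine a p <? combine a q ×-dec combine a (σ a q) <? combine a (σ a p)) (p <? q ×-dec σ a q <? σ a p))

inversionSign-id : ∀ n → inversionSign (id {A = Fin n}) ≡ Sign.+
inversionSign-id zero    = refl
inversionSign-id (suc n) = cong₂ Sign._*_ (∏ˢ-+ {n = n} λ _ → refl) (inversionSign-id n)

-- Lists in which exactly one entry has a property

private
  variable
    a b p q r : Level
    A B C : Set a

-- Uniqueness refers to positions in the list and to a predicate such as `_≗ g`: functions with the
-- same values need not be provably equal, so membership up to `_≡_` would be too strict.
data ExactlyOne {A : Set a} (P : A → Set p) : List A → Set (a ⊔ p) where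
  here  : ∀ {x xs} → P x → All (λ y → ¬ P y) xs → ExactlyOne P (x ∷ xs)
  there : ∀ {x xs} → ¬ P x → ExactlyOne P xs → ExactlyOne P (x ∷ xs)

module _ {A : Set a} {P : A → Set p} where

  exactlyOne-++ˡ : ∀ {xs ys} → ExactlyOne P xs → All (λ y → ¬ P y) ys → ExactlyOne P (xs ++ ys)
  exactlyOne-++ˡ (here px nps) nqs = here px (All.++⁺ nps nqs)
  exactlyOne-++ˡ (there np one) nqs = there np (exactlyOne-++ˡ one nqs)

  exactlyOne-++ʳ : ∀ {xs ys} → All (λ y → ¬ P y) xs → ExactlyOne P ys → ExactlyOne P (xs ++ ys)
  exactlyOne-++ʳ []         one = one
  exactlyOne-++ʳ (np ∷ nps) one = there np (exactlyOne-++ʳ nps one)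

  exactlyOne-map⁺ : {B : Set b} {f : B → A} → ∀ {ys} → ExactlyOne (P ∘ f) ys → ExactlyOne P (List.map f ys)
  exactlyOne-map⁺ (here py nps) = here py (All.map⁺ nps)
  exactlyOne-map⁺ (there np one) = there np (exactlyOne-map⁺ one)

  exactlyOne-⇔ : {Q : A → Set q} → ∀ {xs} → All (λ x → P x ⇔ Q x) xs → ExactlyOne P xs → ExactlyOne Q xs
  exactlyOne-⇔ (e ∷ es) (here px nps) = here (Equivalence.to e px)
    (All.zipWith (λ (e , np) → np ∘ Equivalence.from e) (es , nps))
  exactlyOne-⇔ (e ∷ es) (there np one) = there (np ∘ Equivalence.from e) (exactlyOne-⇔ es one)

  exactlyOne-filter : {Q : A → Set q} (Q? : Decidable Q) → (∀ {x} → P x → Q x) →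
    ∀ {xs} → ExactlyOne P xs → ExactlyOne P (filter Q? xs)
  exactlyOne-filter Q? P⇒Q (here {x} px nps) with Q? x
  ... | yes _  = here px (All.filter⁺ Q? nps)
  ... | no ¬qx = contradiction (P⇒Q px) ¬qx
  exactlyOne-filter Q? P⇒Q (there {x} np one) with Q? x
  ... | yes _ = there np (exactlyOne-filter Q? P⇒Q one)
  ... | no _  = exactlyOne-filter Q? P⇒Q one

  exactlyOne-tabulate : ∀ {n} {f : Fin n → A} i → P (f i) → (∀ j → P (f j) → j ≡ i) →
    ExactlyOne P (tabulate f)
  exactlyOne-tabulate zero    pi uniq = here pi (All.tabulate⁺ λ j pj → contradiction (uniq (suc j) pj) λ ())
  exactlyOne-tabulate (suc i) pi uniq = there (λ p0 → contradiction (uniq zero p0) λ ())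
    (exactlyOne-tabulate i pi λ j pj → case uniq (suc j) pj of λ { refl → refl })

exactlyOne-cartesianProductWith :
  {A : Set a} {B : Set b} {P : A → Set p} {Q : B → Set q} {R : C → Set r} {g : A → B → C} →
  (∀ x y → P x → Q y → R (g x y)) → (∀ x y → R (g x y) → P x × Q y) →
  ∀ {xs ys} → ExactlyOne P xs → ExactlyOne Q ys → ExactlyOne R (cartesianProductWith g xs ys)
exactlyOne-cartesianProductWith {A = A} {B} {P} {R = R} {g} to from = go
  where
  none : ∀ {xs} → All (λ x → ¬ P x) xs → ∀ ys → All (λ z → ¬ R z) (cartesianProductWith g xs ys)
  none []         ys = []
  none (np ∷ nps) ys = All.++⁺ (All.map⁺ (All.universal (λ y → np ∘ proj₁ ∘ from _ y) ys)) (none nps ys)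

  go : ∀ {xs ys} → ExactlyOne P xs → ExactlyOne _ ys → ExactlyOne R (cartesianProductWith g xs ys)
  go {ys = ys} (here px nps) one = exactlyOne-++ˡ
    (exactlyOne-map⁺ (exactlyOne-⇔ (All.universal (λ y → record
      { to = to _ y px ; from = proj₂ ∘ from _ y ; to-cong = λ { refl → refl } ; from-cong = λ { refl → refl } }) ys) one))
    (none nps _)
  go {ys = ys} (there np one) one′ = exactlyOne-++ʳ
    (All.map⁺ (All.universal (λ y → np ∘ proj₁ ∘ from _ y) ys)) (go one one′)

-- The first value and the remaining function are chosen independently, so uniqueness passes from
-- the single values to the whole function.
exactlyOne-functions : ∀ {n} {A : Set a} {Q : Fin n → A → Set q} {xs} →
  (∀ i → ExactlyOne (Q i) xs) → ExactlyOne (λ f → ∀ i → Q i (f i)) (functions n xs)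
exactlyOne-functions {n = zero}  ones = here (λ ()) []
exactlyOne-functions {n = suc n} {Q = Q} ones = exactlyOne-cartesianProductWith
  (λ { x f q qs zero → q ; x f q qs (suc i) → qs i }) (λ x f qs → qs zero , qs ∘ suc)
  (ones zero) (exactlyOne-functions {Q = Q ∘ suc} (ones ∘ suc))

all-functions : ∀ n {A : Set a} {P : A → Set p} {xs} → All P xs → All (λ f → ∀ i → P (f i)) (functions n xs)
all-functions zero    ps = (λ ()) ∷ []
all-functions (suc n) {P = P} {xs} ps = go ps
  where
  go : ∀ {ys} → All P ys → All (λ f → ∀ i → P (f i)) (cartesianProductWith Vector._∷_ ys (functions n xs))
  go []       = []
  go (q ∷ qs) = All.++⁺
    (All.map⁺ (All.map (λ h → λ { zero → q ; (suc i) → h i }) (all-functions n ps))) (go qs)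

all-cartesianProduct : {A : Set a} {B : Set b} {P : A → Set p} {Q : B → Set q} →
  ∀ {xs ys} → All P xs → All Q ys → All (λ (x , y) → P x × Q y) (cartesianProduct xs ys)
all-cartesianProduct []       qs = []
all-cartesianProduct (p ∷ ps) qs = All.++⁺ (All.map⁺ (All.map (p ,_) qs)) (all-cartesianProduct ps qs)

-- Sums over lists in a commutative monoid

module ListSum {c ℓ} (M : CommutativeMonoid c ℓ) where
  open CommutativeMonoid M renaming (refl to ≈-refl; sym to ≈-sym; trans to ≈-trans)
  open SetoidReasoning setoid
  open import Algebra.Properties.CommutativeSemigroup commutativeSemigroup using (interchange)

  ∑ : List A → (A → Carrier) → Carrier
  ∑ xs h = foldr _∙_ ε (List.map h xs)

  ∑-cong-All : ∀ {xs : List A} {g h : A → Carrier} → All (λ x → g x ≈ h x) xs → ∑ xs g ≈ ∑ xs h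
  ∑-cong-All []       = ≈-refl
  ∑-cong-All (e ∷ es) = ∙-cong e (∑-cong-All es)

  ∑-cong : ∀ (xs : List A) {g h : A → Carrier} → (∀ x → g x ≈ h x) → ∑ xs g ≈ ∑ xs h
  ∑-cong xs e = ∑-cong-All (All.universal e xs)

  ∑-zero-All : ∀ {xs : List A} {h : A → Carrier} → All (λ x → h x ≈ ε) xs → ∑ xs h ≈ ε
  ∑-zero-All []       = ≈-refl
  ∑-zero-All (e ∷ es) = ≈-trans (∙-cong e (∑-zero-All es)) (identityˡ ε)

  ∑-zero : ∀ (xs : List A) {h : A → Carrier} → (∀ x → h x ≈ ε) → ∑ xs h ≈ ε
  ∑-zero xs e = ∑-zero-All (All.universal e xs)

  ∑-distrib : ∀ (xs : List A) (g h : A → Carrier) → ∑ xs (λ x → g x ∙ h x) ≈ ∑ xs g ∙ ∑ xs h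
  ∑-distrib []       g h = ≈-sym (identityˡ ε)
  ∑-distrib (x ∷ xs) g h = ≈-trans (∙-congˡ (∑-distrib xs g h)) (interchange _ _ _ _)

  ∑-comm : ∀ (xs : List A) (ys : List B) (h : A → B → Carrier) →
           ∑ xs (λ x → ∑ ys (h x)) ≈ ∑ ys (λ y → ∑ xs λ x → h x y)
  ∑-comm []       ys h = ≈-sym (∑-zero ys λ _ → ≈-refl)
  ∑-comm (x ∷ xs) ys h = ≈-trans (∙-congˡ (∑-comm xs ys h)) (≈-sym (∑-distrib ys _ _))

  ∑-++ : ∀ (xs ys : List A) (h : A → Carrier) → ∑ (xs ++ ys) h ≈ ∑ xs h ∙ ∑ ys h
  ∑-++ []       ys h = ≈-sym (identityˡ _)
  ∑-++ (x ∷ xs) ys h = ≈-trans (∙-congˡ (∑-++ xs ys h)) (≈-sym (assoc _ _ _))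

  ∑-map : ∀ (f : A → B) (xs : List A) (h : B → Carrier) → ∑ (List.map f xs) h ≡ ∑ xs (h ∘ f)
  ∑-map f []       h = refl
  ∑-map f (x ∷ xs) h = cong (h (f x) ∙_) (∑-map f xs h)

  ∑-cartesianProductWith : ∀ (f : A → B → C) xs ys (h : C → Carrier) →
    ∑ (cartesianProductWith f xs ys) h ≈ ∑ xs λ x → ∑ ys λ y → h (f x y)
  ∑-cartesianProductWith f []       ys h = ≈-refl
  ∑-cartesianProductWith f (x ∷ xs) ys h = ≈-trans (∑-++ (List.map (f x) ys) _ h)
    (∙-cong (reflexive (∑-map (f x) ys h)) (∑-cartesianProductWith f xs ys h))

  ∑-exactlyOne : ∀ {P : A → Set p} (P? : Decidable P) {xs} → ExactlyOne P xs →
    ∀ c → ∑ xs (λ x → if does (P? x) then c else ε) ≈ c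
  ∑-exactlyOne {P = P} P? (here {x} {xs} px nps) c rewrite dec-true (P? x) px =
    ≈-trans (∙-congˡ (∑-zero-All (All.map vanish nps))) (identityʳ c)
    where
    vanish : ∀ {y} → ¬ P y → (if does (P? y) then c else ε) ≈ ε
    vanish {y} np rewrite dec-false (P? y) np = ≈-refl
  ∑-exactlyOne P? (there {x} np one) c rewrite dec-false (P? x) np =
    ≈-trans (identityˡ _) (∑-exactlyOne P? one c)

  -- Rel is a bijection between the supports of the summands; both sums are
  -- sums over the related pairs.
  ∑-transfer : ∀ {Rel : A → B → Set r} (Rel? : ∀ x y → Dec (Rel x y)) {g : A → Carrier} {h : B → Carrier} {xs ys} →
    All (λ x → g x ≈ ε ⊎ ExactlyOne (Rel x) ys) xs →
    All (λ y → ExactlyOne (λ x → Rel x y) xs) ys →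
    All (λ x → All (λ y → Rel x y → g x ≈ h y) ys) xs →
    ∑ xs g ≈ ∑ ys h
  ∑-transfer {Rel = Rel} Rel? {g} {h} {xs} {ys} left right agree = begin
    ∑ xs g
      ≈⟨ ∑-cong-All (All.map expand left) ⟩
    ∑ xs (λ x → ∑ ys λ y → if does (Rel? x y) then g x else ε)
      ≈⟨ ∑-cong-All (All.map (∑-cong-All ∘ All.map swap) agree) ⟩
    ∑ xs (λ x → ∑ ys λ y → if does (Rel? x y) then h y else ε)
      ≈⟨ ∑-comm xs ys _ ⟩
    ∑ ys (λ y → ∑ xs λ x → if does (Rel? x y) then h y else ε)
      ≈⟨ ∑-cong-All (All.map (λ one → ∑-exactlyOne (λ x → Rel? x _) one _) right) ⟩
    ∑ ys h ∎
    where
    constant : ∀ {c} b → c ≈ ε → (if b then c else ε) ≈ ε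
    constant false e = ≈-refl
    constant true  e = e

    expand : ∀ {x} → g x ≈ ε ⊎ ExactlyOne (Rel x) ys → g x ≈ ∑ ys λ y → if does (Rel? x y) then g x else ε
    expand {x} (inj₁ gx≈ε) = ≈-trans gx≈ε (≈-sym (∑-zero ys λ y → constant (does (Rel? x y)) gx≈ε))
    expand {x} (inj₂ one)  = ≈-sym (∑-exactlyOne (Rel? x) one (g x))

    swap : ∀ {x y} → (Rel x y → g x ≈ h y) → (if does (Rel? x y) then g x else ε) ≈ (if does (Rel? x y) then h y else ε)
    swap {x} {y} e with Rel? x y
    ... | yes rel = e rel
    ... | no _    = ≈-refl

-- Expansion of a power of a sum

module PowerExpansion {c ℓ} (R : Semiring c ℓ) where
  open Semiring R renaming (refl to ≈-refl; sym to ≈-sym; trans to ≈-trans)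
  open ListSum +-commutativeMonoid

  ∏ : ∀ {n} → Vector Carrier n → Carrier
  ∏ = Vector.foldr _*_ 1#

  ∑-distribˡ-* : ∀ (xs : List A) c (h : A → Carrier) → c * ∑ xs h ≈ ∑ xs λ x → c * h x
  ∑-distribˡ-* []       c h = zeroʳ c
  ∑-distribˡ-* (x ∷ xs) c h = ≈-trans (distribˡ c _ _) (+-congˡ (∑-distribˡ-* xs c h))

  ∑-distribʳ-* : ∀ (xs : List A) c (h : A → Carrier) → ∑ xs h * c ≈ ∑ xs λ x → h x * c
  ∑-distribʳ-* []       c h = zeroˡ c
  ∑-distribʳ-* (x ∷ xs) c h = ≈-trans (distribʳ c _ _) (+-congˡ (∑-distribʳ-* xs c h))

  -- Distributivity with the factors kept in order, as the wedge product is not commutative.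
  -- `L^ n (scalar 1#)` is this fold for the sum of the Cayley terms.
  fold-∑ : ∀ (xs : List A) (t : A → Carrier) n →
    fold 1# (∑ xs t *_) n ≈ ∑ (functions n xs) λ T → ∏ (t ∘ T)
  fold-∑ xs t zero    = ≈-sym (+-identityʳ 1#)
  fold-∑ xs t (suc n) = begin
    ∑ xs t * fold 1# (∑ xs t *_) n
      ≈⟨ *-congˡ (fold-∑ xs t n) ⟩
    ∑ xs t * ∑ (functions n xs) (λ T → ∏ (t ∘ T))
      ≈⟨ ∑-distribʳ-* xs _ t ⟩
    ∑ xs (λ x → t x * ∑ (functions n xs) λ T → ∏ (t ∘ T))
      ≈⟨ ∑-cong xs (λ x → ∑-distribˡ-* (functions n xs) (t x) _) ⟩
    ∑ xs (λ x → ∑ (functions n xs) λ T → t x * ∏ (t ∘ T))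
      ≈⟨ ∑-cartesianProductWith Vector._∷_ xs (functions n xs) _ ⟨
    ∑ (functions (suc n) xs) (λ T → ∏ (t ∘ T)) ∎
    where open SetoidReasoning setoid

-- Signs of lists and wedge products of lists of vectors

open CommutativeSemigroupProperties Sign.*-commutativeSemigroup using () renaming (x∙yz≈y∙xz to x*yz≡y*xz)

-- The parity of the inversions that `x` forms with the entries of a list standing to its right.
crossings : ∀ {n} → Fin n → List (Fin n) → Sign
crossings x = foldr (λ y s → χ (does (y <? x)) Sign.* s) Sign.+

listSign : ∀ {n} → List (Fin n) → Sign
listSign []       = Sign.+
listSign (x ∷ xs) = crossings x xs Sign.* listSign xs

crossings-↭ : ∀ {n} (x : Fin n) {xs ys} → xs ↭ ys → crossings x xs ≡ crossings x ys
crossings-↭ x Perm.refl           = refl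
crossings-↭ x (Perm.prep y p)     = cong (χ (does (y <? x)) Sign.*_) (crossings-↭ x p)
crossings-↭ x (Perm.swap y z p) rewrite crossings-↭ x p =
  x*yz≡y*xz (χ (does (y <? x))) (χ (does (z <? x))) _
crossings-↭ x (Perm.trans p q)    = trans (crossings-↭ x p) (crossings-↭ x q)

crossings-tabulate : ∀ {m n} (x : Fin n) (f : Fin m → Fin n) →
  crossings x (tabulate f) ≡ ∏ˢ λ i → χ (does (f i <? x))
crossings-tabulate {zero}  x f = refl
crossings-tabulate {suc m} x f = cong (χ (does (f zero <? x)) Sign.*_) (crossings-tabulate x (f ∘ suc))

listSign-tabulate : ∀ {m n} (f : Fin m → Fin n) → listSign (tabulate f) ≡ inversionSign f
listSign-tabulate {zero}  f = refl
listSign-tabulate {suc m} f =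
  cong₂ Sign._*_ (crossings-tabulate (f zero) (f ∘ suc)) (listSign-tabulate (f ∘ suc))

-- Both lists are free of repetitions and have the same elements.
tabulate-↭-allFin : ∀ {m n} {f : Fin m → Fin n} → Bijective _≡_ _≡_ f → tabulate f ↭ allFin n
tabulate-↭-allFin {f = f} (inj , sur) = ∼bag⇒↭ (unique∧set⇒bag (tabulate⁺ inj) (allFin⁺ _)
  λ {y} → mk⇔ (λ _ → ∈-allFin y) λ _ →
    subst (_∈ tabulate f) (proj₂ (sur y) refl) (∈-tabulate⁺ (proj₁ (sur y))))

module Wedge {c ℓ} (R : CommutativeRing c ℓ) (d k : ℕ) where
  open CommutativeRing R using (Carrier; _≈_; 0#; 1#; -_)
  open Representation R d k
  private module R = CommutativeRing R
  open RingProperties R.ring using (-‿involutive; -1*x≈-x)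
  open RingProperties ⋀-ring using () renaming (+-inverseˡ-unique to ⊕-inverseˡ-unique)
  open SetoidReasoning (Ring.setoid ⋀-ring)

  ⟦⟧-* : ∀ s t → ⟦ s Sign.* t ⟧ ≈ ⟦ s ⟧ R.* ⟦ t ⟧
  ⟦⟧-* Sign.+ t      = R.sym (R.*-identityˡ _)
  ⟦⟧-* Sign.- Sign.+ = R.sym (R.*-identityʳ _)
  ⟦⟧-* Sign.- Sign.- = R.sym (R.trans (-1*x≈-x _) (-‿involutive _))

  signed : Sign → ⋀ → ⋀
  signed s x = scalar ⟦ s ⟧ ∧ x

  signed-cong : ∀ s {x y} → x ≈^ y → signed s x ≈^ signed s y
  signed-cong s = ∧-cong ≈-refl

  signed-reflexive : ∀ {s t x} → s ≡ t → signed s x ≈^ signed t x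
  signed-reflexive refl = ≈-refl

  signed-* : ∀ s t x → signed (s Sign.* t) x ≈^ signed s (signed t x)
  signed-* s t x = ≈-trans (∧-cong (≈-trans (scalar-cong (⟦⟧-* s t)) (scalar-* _ _)) ≈-refl) (∧-assoc _ _ _)

  ∧-zeroʳ : ∀ x → x ∧ scalar 0# ≈^ scalar 0#
  ∧-zeroʳ = Ring.zeroʳ ⋀-ring

  signed-zero : ∀ s {x} → x ≈^ scalar 0# → signed s x ≈^ scalar 0#
  signed-zero s e = ≈-trans (signed-cong s e) (∧-zeroʳ _)

  scalar-∧-commute : ∀ a x y → x ∧ (scalar a ∧ y) ≈^ scalar a ∧ (x ∧ y)
  scalar-∧-commute a x y = ≈-trans (≈-sym (∧-assoc _ _ _))
    (≈-trans (∧-cong (≈-sym (scalar-central a x)) ≈-refl) (∧-assoc _ _ _))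

  -- Polarisation: the square of the sum `u +ᴹ w` vanishes, and so do the two pure squares in its
  -- expansion.
  ι-anticommute : ∀ u w → ι u ∧ ι w ≈^ signed Sign.- (ι w ∧ ι u)
  ι-anticommute u w = ⊕-inverseˡ-unique _ _ sum≈0
    where
    sum≈0 : ι u ∧ ι w ⊕ ι w ∧ ι u ≈^ scalar 0#
    sum≈0 = begin
      ι u ∧ ι w ⊕ ι w ∧ ι u
        ≈⟨ ⊕-cong (Ring.+-identityˡ ⋀-ring _) (Ring.+-identityʳ ⋀-ring _) ⟨
      (scalar 0# ⊕ ι u ∧ ι w) ⊕ (ι w ∧ ι u ⊕ scalar 0#)
        ≈⟨ ⊕-cong (⊕-cong (ι-squares u) ≈-refl) (⊕-cong ≈-refl (ι-squares w)) ⟨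
      (ι u ∧ ι u ⊕ ι u ∧ ι w) ⊕ (ι w ∧ ι u ⊕ ι w ∧ ι w)
        ≈⟨ ⊕-cong (∧-distribˡ _ _ _) (∧-distribˡ _ _ _) ⟨
      ι u ∧ (ι u ⊕ ι w) ⊕ ι w ∧ (ι u ⊕ ι w)
        ≈⟨ ∧-distribʳ _ _ _ ⟨
      (ι u ⊕ ι w) ∧ (ι u ⊕ ι w)
        ≈⟨ ∧-cong (ι-+ u w) (ι-+ u w) ⟨
      ι (u +ᴹ w) ∧ ι (u +ᴹ w)
        ≈⟨ ι-squares (u +ᴹ w) ⟩
      scalar 0# ∎
      where open LeftModule V using (_+ᴹ_)

  ι-anticommute-∧ : ∀ u w x → ι u ∧ ι w ∧ x ≈^ signed Sign.- (ι w ∧ ι u ∧ x)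
  ι-anticommute-∧ u w x = ≈-trans (≈-sym (∧-assoc _ _ _)) (≈-trans (∧-cong (ι-anticommute u w) ≈-refl)
    (≈-trans (∧-assoc _ _ _) (signed-cong Sign.- (∧-assoc _ _ _))))

  ι-square-∧ : ∀ u x → ι u ∧ ι u ∧ x ≈^ scalar 0#
  ι-square-∧ u x = ≈-trans (≈-sym (∧-assoc _ _ _)) (≈-trans (∧-cong (ι-squares u) ≈-refl) (∧-zeroˡ x))

  module _ {n} (v : Fin n → LeftModule.Carrierᴹ V) where

    wedge : List (Fin n) → ⋀
    wedge = foldr (λ x → ι (v x) ∧_) (scalar 1#)

    signedWedge : List (Fin n) → ⋀
    signedWedge xs = signed (listSign xs) (wedge xs)

    signedWedge-∷ : ∀ x xs → signedWedge (x ∷ xs) ≈^ signed (crossings x xs) (ι (v x) ∧ signedWedge xs)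
    signedWedge-∷ x xs = ≈-trans (signed-* (crossings x xs) (listSign xs) _)
      (signed-cong (crossings x xs) (≈-sym (scalar-∧-commute _ _ _)))

    signedWedge-∷∷ : ∀ x y xs → signedWedge (x ∷ y ∷ xs) ≈^
      signed (crossings x (y ∷ xs) Sign.* crossings y xs) (ι (v x) ∧ ι (v y) ∧ signedWedge xs)
    signedWedge-∷∷ x y xs = ≈-trans (signedWedge-∷ x (y ∷ xs)) (≈-trans
      (signed-cong (crossings x (y ∷ xs)) (≈-trans (∧-cong ≈-refl (signedWedge-∷ y xs)) (scalar-∧-commute _ _ _)))
      (≈-sym (signed-* (crossings x (y ∷ xs)) (crossings y xs) _)))

    -- Exchanging two different neighbours flips both the sign of the list and the wedge product, so
    -- the changes cancel; with equal neighbours both sides are zero.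
    signedWedge-↭ : ∀ {xs ys} → xs ↭ ys → signedWedge xs ≈^ signedWedge ys
    signedWedge-↭ Perm.refl = ≈-refl
    signedWedge-↭ (Perm.prep {xs = xs} {ys} x p) = ≈-trans (signedWedge-∷ x xs) (≈-trans
      (≈-trans (signed-reflexive (crossings-↭ x p)) (signed-cong (crossings x ys) (∧-cong ≈-refl (signedWedge-↭ p))))
      (≈-sym (signedWedge-∷ x ys)))
    signedWedge-↭ (Perm.swap {xs = xs} {ys} x y p) with x ≟ y
    ... | yes refl = ≈-trans (vanish xs) (≈-sym (vanish ys))
      where
      vanish : ∀ zs → signedWedge (x ∷ x ∷ zs) ≈^ scalar 0#
      vanish zs = signed-zero (listSign (x ∷ x ∷ zs)) (ι-square-∧ (v x) (wedge zs))
    ... | no x≢y = begin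
      signedWedge (x ∷ y ∷ xs)
        ≈⟨ signedWedge-∷∷ x y xs ⟩
      signed s (ι (v x) ∧ ι (v y) ∧ signedWedge xs)
        ≈⟨ signed-cong s (ι-anticommute-∧ (v x) (v y) _) ⟩
      signed s (signed Sign.- (ι (v y) ∧ ι (v x) ∧ signedWedge xs))
        ≈⟨ signed-* s Sign.- _ ⟨
      signed (s Sign.* Sign.-) (ι (v y) ∧ ι (v x) ∧ signedWedge xs)
        ≈⟨ signed-reflexive opposite ⟩
      signed t (ι (v y) ∧ ι (v x) ∧ signedWedge xs)
        ≈⟨ signed-cong t (∧-cong ≈-refl (∧-cong ≈-refl (signedWedge-↭ p))) ⟩
      signed t (ι (v y) ∧ ι (v x) ∧ signedWedge ys)
        ≈⟨ signedWedge-∷∷ y x ys ⟨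
      signedWedge (y ∷ x ∷ ys) ∎
      where
      s = crossings x (y ∷ xs) Sign.* crossings y xs
      t = crossings y (x ∷ ys) Sign.* crossings x ys
      -- Exactly one of `s` and `t` receives `-` from the comparison of `x` with `y`: `rearrange`
      -- treats `x < y`, and `rearrange′` treats `y < x`.
      rearrange : ∀ a b → (Sign.+ Sign.* a Sign.* b) Sign.* Sign.- ≡ Sign.- Sign.* b Sign.* a
      rearrange Sign.+ Sign.+ = refl
      rearrange Sign.+ Sign.- = refl
      rearrange Sign.- Sign.+ = refl
      rearrange Sign.- Sign.- = refl
      rearrange′ : ∀ a b → (Sign.- Sign.* a Sign.* b) Sign.* Sign.- ≡ Sign.+ Sign.* b Sign.* a
      rearrange′ Sign.+ Sign.+ = refl
      rearrange′ Sign.+ Sign.- = refl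
      rearrange′ Sign.- Sign.+ = refl
      rearrange′ Sign.- Sign.- = refl
      opposite : s Sign.* Sign.- ≡ t
      opposite rewrite crossings-↭ x p | crossings-↭ y p with <-cmp x y
      ... | tri≈ _ x≡y _ = contradiction x≡y x≢y
      ... | tri< x<y _ y≮x rewrite dec-true (x <? y) x<y | dec-false (y <? x) y≮x =
        rearrange (crossings x ys) (crossings y ys)
      ... | tri> x≮y _ y<x rewrite dec-false (x <? y) x≮y | dec-true (y <? x) y<x =
        rearrange′ (crossings x ys) (crossings y ys)
    signedWedge-↭ (Perm.trans p q) = ≈-trans (signedWedge-↭ p) (signedWedge-↭ q)

    -- Anticommutation moves `ι (v x)` to the right until it meets its second copy, where the square
    -- vanishes.
    ∈⇒∧-wedge≈0 : ∀ {x xs} → x ∈ xs → ι (v x) ∧ wedge xs ≈^ scalar 0#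
    ∈⇒∧-wedge≈0 {xs = _ ∷ xs} (here refl) = ι-square-∧ _ (wedge xs)
    ∈⇒∧-wedge≈0 {x} {y ∷ xs} (there x∈xs) = ≈-trans (ι-anticommute-∧ (v x) (v y) (wedge xs))
      (signed-zero Sign.- (≈-trans (∧-cong ≈-refl (∈⇒∧-wedge≈0 x∈xs)) (∧-zeroʳ _)))

    wedge-repeated : ∀ {m} {f : Fin m → Fin n} i j → i < j → f i ≡ f j → wedge (tabulate f) ≈^ scalar 0#
    wedge-repeated {f = f} zero (suc j) i<j eq =
      ∈⇒∧-wedge≈0 (subst (_∈ tabulate (f ∘ suc)) (sym eq) (∈-tabulate⁺ {f = f ∘ suc} j))
    wedge-repeated {f = f} (suc i) (suc j) i<j eq =
      ≈-trans (∧-cong ≈-refl (wedge-repeated {f = f ∘ suc} i j (s<s⁻¹ i<j) eq)) (∧-zeroʳ _)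

    -- `signedWedge` is invariant under reordering, and the increasing list has sign `+`.
    wedge-bijective : ∀ {m} {f : Fin m → Fin n} → Bijective _≡_ _≡_ f →
      wedge (tabulate f) ≈^ signed (inversionSign f) (wedge (allFin n))
    wedge-bijective {f = f} bij = begin
      wedge (tabulate f)
        ≈⟨ ∧-identityˡ _ ⟨
      signed Sign.+ (wedge (tabulate f))
        -- A sign is its own inverse: one copy of `s` completes the wedge to `signedWedge`, the
        -- other one stays in front.
        ≈⟨ signed-reflexive (Sign.s*s≡+ s) ⟨
      signed (s Sign.* s) (wedge (tabulate f))
        ≈⟨ signed-* s s _ ⟩
      signed s (signed s (wedge (tabulate f)))
        ≈⟨ signed-cong s (signed-reflexive (sym (listSign-tabulate f))) ⟩
      signed s (signedWedge (tabulate f))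
        ≈⟨ signed-cong s (signedWedge-↭ (tabulate-↭-allFin bij)) ⟩
      signed s (signedWedge (allFin n))
        ≈⟨ signed-cong s (signed-reflexive (trans (listSign-tabulate {n} id) (inversionSign-id n))) ⟩
      signed s (signed Sign.+ (wedge (allFin n)))
        ≈⟨ signed-cong s (∧-identityˡ _) ⟩
      signed s (wedge (allFin n)) ∎
      where s = inversionSign f

-- Permutations, and coordinates of points of the cube

IsPermutation : ∀ {n} → (Fin n → Fin n) → Set
IsPermutation = Bijective _≡_ _≡_

isPermutation-resp-≗ : ∀ {n} {f g : Fin n → Fin n} → f ≗ g → IsPermutation f → IsPermutation g
isPermutation-resp-≗ f≗g (inj , sur) =
  (λ eq → inj (trans (f≗g _) (trans eq (sym (f≗g _))))) ,
  λ y → proj₁ (sur y) , λ { refl → trans (sym (f≗g _)) (proj₂ (sur y) refl) }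

all-S : ∀ n → All IsPermutation (S n)
all-S n = All.all-filter bijective? (functions n (allFin n))

exactlyOne-functions-allFin : ∀ {m n} (g : Fin m → Fin n) → ExactlyOne (_≗ g) (functions m (allFin n))
exactlyOne-functions-allFin g = exactlyOne-functions {Q = λ i x → x ≡ g i} λ i →
  exactlyOne-tabulate (g i) refl λ _ → id

exactlyOne-S : ∀ {n} {σ : Fin n → Fin n} → IsPermutation σ → ExactlyOne (_≗ σ) (S n)
exactlyOne-S {σ = σ} perm = exactlyOne-filter bijective?
  (λ f≗σ → isPermutation-resp-≗ (sym ∘ f≗σ) perm) (exactlyOne-functions-allFin σ)

compose-isPermutation : ∀ {d n} (π : Fin d → Fin n → Fin n) → (∀ l → IsPermutation (π l)) → IsPermutation (compose π)
compose-isPermutation {zero}  π perms = id , λ y → y , id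
compose-isPermutation {suc d} π perms =
  ∘-bijective (perms zero) (compose-isPermutation (π ∘ suc) (perms ∘ suc))

sgn-compose : ∀ {d n} (π : Fin d → Fin n → Fin n) → (∀ l → IsPermutation (π l)) → sgn (compose π) ≡ ∏ˢ λ l → sgn (π l)
sgn-compose {zero} {n} π perms = inversionSign-id n
sgn-compose {suc d} π perms = begin
  inversionSign (π zero ∘ compose (π ∘ suc))
    ≡⟨ inversionSign-∘ (compose-isPermutation (π ∘ suc) (perms ∘ suc)) (proj₁ (perms zero)) ⟩
  sgn (compose (π ∘ suc)) Sign.* sgn (π zero)
    ≡⟨ Sign.*-comm (sgn (compose (π ∘ suc))) (sgn (π zero)) ⟩
  sgn (π zero) Sign.* sgn (compose (π ∘ suc))
    ≡⟨ cong (sgn (π zero) Sign.*_) (sgn-compose (π ∘ suc) (perms ∘ suc)) ⟩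
  sgn (π zero) Sign.* ∏ˢ (λ l → sgn (π (suc l))) ∎
  where open ≡-Reasoning

-- Equal signs cancel in pairs. Here the parity of `d` enters: the sign of the listing occurs once
-- per direction, and one copy survives.
∏ˢ-const-odd : ∀ n s → 2 ∤ n → ∏ˢ {n} (λ _ → s) ≡ s
∏ˢ-const-odd zero          s 2∤n = contradiction (divides 0 refl) 2∤n
∏ˢ-const-odd (suc zero)    s 2∤n = Sign.*-identityʳ s
∏ˢ-const-odd (suc (suc n)) s 2∤n = begin
  s Sign.* (s Sign.* t)  ≡⟨ Sign.*-assoc s s t ⟨
  s Sign.* s Sign.* t    ≡⟨ cong (Sign._* t) (Sign.s*s≡+ s) ⟩
  t                      ≡⟨ ∏ˢ-const-odd n s (λ { (divides q eq) → 2∤n (divides (suc q) (cong (λ n → suc (suc n)) eq)) }) ⟩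
  s                      ∎
  where
  open ≡-Reasoning
  t = ∏ˢ {n} (λ _ → s)

funToFin-cong : ∀ {m n} {f g : Fin m → Fin n} → f ≗ g → funToFin f ≡ funToFin g
funToFin-cong {zero}  eq = refl
funToFin-cong {suc m} eq = cong₂ combine (eq zero) (funToFin-cong (eq ∘ suc))

insertAt-cong : ∀ {a} {A : Set a} {n} {xs ys : Vector A n} (l : Fin (suc n)) {x y} → xs ≗ ys → x ≡ y →
  insertAt xs l x ≗ insertAt ys l y
insertAt-cong zero            xs≗ys x≡y zero    = x≡y
insertAt-cong zero            xs≗ys x≡y (suc j) = xs≗ys j
insertAt-cong {n = suc n} (suc l) xs≗ys x≡y zero    = xs≗ys zero
insertAt-cong {n = suc n} (suc l) xs≗ys x≡y (suc j) = insertAt-cong l (xs≗ys ∘ suc) x≡y j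

∃-preimage : ∀ {m n} {f : Fin m → Fin n} → Surjective _≡_ _≡_ f → ∀ y → ∃ λ x → f x ≡ y
∃-preimage sur y = proj₁ (sur y) , proj₂ (sur y) refl

-- Tables of permutations and Latin hypercubes

module LatinHypercubes (e k : ℕ) where

  -- The lexicographic rank of `x` within the slice in direction `l` that contains it.
  position : Fin (suc e) → Cube (suc e) k → Fin (k ^ e)
  position l x = funToFin (removeAt x l)

  insertAt-position : ∀ l x → insertAt (finToFun (position l x)) l (x l) ≗ x
  insertAt-position l x j = trans
    (insertAt-cong l (finToFun-funToFin (removeAt x l)) refl j) (insertAt-removeAt x l j)

  -- Hypercubes are handled as maps on codes of points, since `cubeMaps` consists of the composites
  -- of such maps with `funToFin`.
  Filling : Set
  Filling = Fin (k ^ suc e) → Fin (k ^ e)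

  IsLatinFilling : Filling → Set
  IsLatinFilling C = IsLatin {e} {k} (C ∘ funToFin)

  slice : Filling → Fin (suc e) → Fin k → Fin (k ^ e) → Fin (k ^ e)
  slice C = onSlice {e} {k} (C ∘ funToFin)

  slice-position : ∀ C l x → slice C l (x l) (position l x) ≡ C (funToFin x)
  slice-position C l x = cong C (funToFin-cong (insertAt-position l x))

  -- A choice of one Cayley term from each of the `k ^ e` factors of the power: `T m l` is the
  -- permutation for direction `l` in factor `m`. The index `m` also serves as a symbol of the
  -- hypercube.
  Table : Set
  Table = Fin (k ^ e) → Fin (suc e) → Fin k → Fin k

  IsPermutationTable : Table → Set
  IsPermutationTable T = ∀ m l → IsPermutation (T m l)

  cell : Table → Fin (k ^ e) → Fin k → Cube (suc e) k
  cell T m i l = T m l i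

  -- `combine m i` is the place of the `i`-th vector of the `m`-th factor in the expanded product;
  -- the value is the code of the point that indexes this basis vector.
  cells : Table → Fin (k ^ e ℕ.* k) → Fin (k ^ suc e)
  cells T z = uncurry (λ m i → funToFin (cell T m i)) (remQuot k z)

  cells-combine : ∀ T m i → cells T (combine m i) ≡ funToFin (cell T m i)
  cells-combine T m i = cong (uncurry λ m i → funToFin (cell T m i)) (remQuot-combine m i)

  coordinates : Fin (k ^ suc e) → Cube (suc e) k
  coordinates = finToFun

  coordinates-cells : ∀ T m i → coordinates (cells T (combine m i)) ≗ cell T m i
  coordinates-cells T m i l = trans (cong (λ y → coordinates y l) (cells-combine T m i)) (finToFun-funToFin (cell T m i) l)

  cells-cardinality : k ^ e ℕ.* k ≡ k ^ suc e
  cells-cardinality = ℕ.*-comm (k ^ e) k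

  combine-elim : ∀ {ℓ m n} (P : Fin (m ℕ.* n) → Set ℓ) → (∀ (i : Fin m) (j : Fin n) → P (combine i j)) → ∀ z → P z
  combine-elim {m = m} {n} P p z = subst P (combine-remQuot {m} n z) (uncurry p (remQuot n z))

  -- T lists the cells of each symbol of C, ordered by τ in direction zero.
  Lists : Table → (Fin (k ^ e) → Fin k → Fin k) × Filling → Set
  Lists T (τ , C) = (∀ m i → C (funToFin (cell T m i)) ≡ m) × (∀ m i → τ m i ≡ T m zero i)

  lists? : ∀ T τC → Dec (Lists T τC)
  lists? T (τ , C) =
    (all? λ m → all? λ i → C (funToFin (cell T m i)) ≟ m) ×-dec (all? λ m → all? λ i → τ m i ≟ T m zero i)

  module _ T τ C (lists : Lists T (τ , C)) where

    private
      symbol = proj₁ lists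
      order  = proj₂ lists

    symbol-cells : ∀ m i → C (cells T (combine m i)) ≡ m
    symbol-cells m i = trans (cong C (cells-combine T m i)) (symbol m i)

    -- The symbol of a cell recovers the row `m`; then its coordinate zero recovers the index `i`,
    -- as `τ m` is injective.
    cells-bijective : (∀ m → IsPermutation (τ m)) → Bijective _≡_ _≡_ (cells T)
    cells-bijective perms = injective⇒bijective cells-cardinality λ {z} {w} → inj z w
      where
      inj : ∀ z w → cells T z ≡ cells T w → z ≡ w
      inj = combine-elim _ λ m i → combine-elim _ λ m′ i′ eq →
        same m m′ i i′ (trans (sym (symbol-cells m i)) (trans (cong C eq) (symbol-cells m′ i′))) eq
        where
        same : ∀ m m′ i i′ → m ≡ m′ → cells T (combine m i) ≡ cells T (combine m′ i′) → combine m i ≡ combine m′ i′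
        same m m i i′ refl eq = cong (combine m) (proj₁ (perms m) (begin
          τ m i                                   ≡⟨ order m i ⟩
          T m zero i                              ≡⟨ coordinates-cells T m i zero ⟨
          coordinates (cells T (combine m i)) zero   ≡⟨ cong (λ y → coordinates y zero) eq ⟩
          coordinates (cells T (combine m i′)) zero  ≡⟨ coordinates-cells T m i′ zero ⟩
          T m zero i′                             ≡⟨ order m i′ ⟨
          τ m i′                                  ∎))
          where open ≡-Reasoning

    -- The symbol `m` occurs in the slice where coordinate `l` is `a`, by the Latin property. That
    -- cell is listed somewhere, and its symbol forces the row to be `m`, so `T m l` takes the value
    -- `a`.
    table-isPermutation : (∀ m → IsPermutation (τ m)) → IsLatinFilling C → IsPermutationTable T
    table-isPermutation perms latin m l = surjective⇒bijective refl sur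
      where
      sur : ∀ a → ∃ λ i → T m l i ≡ a
      sur a = found (proj₁ hit) (proj₂ hit)
        where
        at = ∃-preimage (proj₂ (latin l a)) m
        x = insertAt (finToFun (proj₁ at)) l a
        hit = ∃-preimage (proj₂ (cells-bijective perms)) (funToFin x)
        found : ∀ z → cells T z ≡ funToFin x → ∃ λ i → T m l i ≡ a
        found = combine-elim _ λ m′ i eq → i , (begin
          T m l i   ≡⟨ cong (λ m → T m l i) (trans (sym (proj₂ at)) (trans (cong C (sym eq)) (symbol-cells m′ i))) ⟩
          T m′ l i  ≡⟨ coordinates-cells T m′ i l ⟨
          coordinates (cells T (combine m′ i)) l  ≡⟨ cong (λ y → coordinates y l) eq ⟩
          coordinates (funToFin x) l  ≡⟨ finToFun-funToFin x l ⟩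
          x l       ≡⟨ insertAt-lookup (finToFun (proj₁ at)) l a ⟩
          a         ∎)
          where open ≡-Reasoning

    slice-cell : ∀ m l i → slice C l (T m l i) (position l (cell T m i)) ≡ m
    slice-cell m l i = trans (slice-position C l (cell T m i)) (symbol m i)

    -- Row `m` meets every slice, because `T m l` takes every value, and its cells carry the symbol
    -- `m`; so every symbol occurs in every slice.
    filling-isLatin : IsPermutationTable T → IsLatinFilling C
    filling-isLatin perms l a = surjective⇒bijective refl λ m →
      let i , eq = ∃-preimage (proj₂ (perms m l)) a in
      position l (cell T m i) , trans (cong (λ a → slice C l a (position l (cell T m i))) (sym eq)) (slice-cell m l i)

  exactlyOne-tables : ∀ {T : Table} → IsPermutationTable T →
    ExactlyOne (λ T′ → ∀ m l → T′ m l ≗ T m l) (functions (k ^ e) (functions (suc e) (S k)))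
  exactlyOne-tables {T} perms = exactlyOne-functions {Q = λ m π → ∀ l → π l ≗ T m l} λ m →
    exactlyOne-functions {Q = λ l σ → σ ≗ T m l} λ l → exactlyOne-S (perms m l)

  module _ {τ : Fin (k ^ e) → Fin k → Fin k} {C : Filling}
           (perms : ∀ m → IsPermutation (τ m)) (latin : IsLatinFilling C) where

    private
      preimage : ∀ a m → ∃ λ p → slice C zero a p ≡ m
      preimage a = ∃-preimage (proj₂ (latin zero a))

    -- Symbol `m` occurs once in each slice of direction zero; `τ m` decides the order in which
    -- these `k` occurrences are listed.
    listing : Table
    listing m l i = insertAt (finToFun (proj₁ (preimage (τ m i) m))) zero (τ m i) l

    listing-lists : Lists listing (τ , C)
    listing-lists = (λ m i → proj₂ (preimage (τ m i) m)) , λ m i → refl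

    -- `Lists` prescribes coordinate zero of each cell, and injectivity of `C` on that slice
    -- determines its other coordinates.
    lists⇔listing : ∀ T → (∀ m l → T m l ≗ listing m l) ⇔ Lists T (τ , C)
    lists⇔listing T = mk⇔
      (λ eq → (λ m i → trans (cong C (funToFin-cong λ l → eq m l i)) (proj₁ listing-lists m i)) ,
              λ m i → sym (eq m zero i))
      λ rel@(_ , order) m l i → begin
        T m l i
          ≡⟨ insertAt-position zero (cell T m i) l ⟨
        insertAt (finToFun (position zero (cell T m i))) zero (T m zero i) l
          ≡⟨ insertAt-cong zero (λ j → cong (λ p → finToFun p j) (proj₁ (latin zero (τ m i)) (begin
               slice C zero (τ m i) (position zero (cell T m i))
                 ≡⟨ cong (λ a → slice C zero a (position zero (cell T m i))) (order m i) ⟩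
               slice C zero (T m zero i) (position zero (cell T m i))
                 ≡⟨ slice-cell T τ C rel m zero i ⟩
               m
                 ≡⟨ proj₂ (preimage (τ m i) m) ⟨
               slice C zero (τ m i) (proj₁ (preimage (τ m i) m)) ∎))) (sym (order m i)) l ⟩
        listing m l i ∎
      where open ≡-Reasoning

    exactlyOne-listing : ExactlyOne (λ T → Lists T (τ , C)) (functions (k ^ e) (functions (suc e) (S k)))
    exactlyOne-listing = exactlyOne-⇔ (All.universal lists⇔listing _)
      (exactlyOne-tables (table-isPermutation listing τ C listing-lists perms latin))

  isLatinFilling? : ∀ C → Dec (IsLatinFilling C)
  isLatinFilling? C = isLatin? {e} {k} (C ∘ funToFin)

  latinFillings : List Filling
  latinFillings = filter isLatinFilling? (functions (k ^ suc e) (allFin (k ^ e)))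

  module _ {T : Table} (perms : IsPermutationTable T) (bij : Bijective _≡_ _≡_ (cells T)) where

    private
      preimage : ∀ y → ∃ λ z → cells T z ≡ y
      preimage = ∃-preimage (proj₂ bij)

    filling : Filling
    filling y = quotient k (proj₁ (preimage y))

    filling-lists : Lists T ((λ m → T m zero) , filling)
    filling-lists = (λ m i → trans
      (cong (quotient k) (proj₁ bij (trans (proj₂ (preimage (funToFin (cell T m i)))) (sym (cells-combine T m i)))))
      (cong proj₁ (remQuot-combine {k = k} m i))) , λ m i → refl

    -- Every cell is listed, so the row containing it forces its symbol, while `τ` is read off from
    -- direction zero.
    lists⇔filling : ∀ τC → ((∀ m → proj₁ τC m ≗ T m zero) × (proj₂ τC ≗ filling)) ⇔ Lists T τC
    lists⇔filling (τ , C) = mk⇔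
      (λ (eq , eq′) → (λ m i → trans (eq′ _) (proj₁ filling-lists m i)) , eq)
      λ rel@(symbol , order) → order , λ y → let z , eq = preimage y in
        trans (cong C (sym eq)) (combine-elim (λ z → C (cells T z) ≡ quotient k z)
          (λ m i → trans (symbol-cells T τ C rel m i) (sym (cong proj₁ (remQuot-combine {k = k} m i)))) z)

    exactlyOne-filling : ExactlyOne (Lists T) (cartesianProduct (functions (k ^ e) (S k)) latinFillings)
    exactlyOne-filling = exactlyOne-⇔ (All.universal lists⇔filling _)
      (exactlyOne-cartesianProductWith {P = λ τ → ∀ m → τ m ≗ T m zero} {Q = _≗ filling} (λ _ _ → _,_) (λ _ _ → id)
        (exactlyOne-functions {Q = λ m σ → σ ≗ T m zero} λ m → exactlyOne-S (perms m zero))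
        (exactlyOne-filter isLatinFilling?
          (λ {C} eq → filling-isLatin T (λ m → T m zero) C
            ((λ m i → trans (eq _) (proj₁ filling-lists m i)) , λ m i → refl) perms)
          (exactlyOne-functions-allFin filling)))

  -- Signs of tables and of Latin hypercubes

  transposed : Fin (k ^ e ℕ.* k) → Fin (k ℕ.* k ^ e)
  transposed z = uncurry (λ m i → combine i m) (remQuot k z)

  transposed-injective : Injective _≡_ _≡_ transposed
  transposed-injective {z} {w} = inj z w
    where
    inj : ∀ z w → transposed z ≡ transposed w → z ≡ w
    inj = combine-elim _ λ m i → combine-elim _ λ m′ i′ eq →
      let i≡i′ , m≡m′ = combine-injective i m i′ m′
            (trans (sym (transposed-combine m i)) (trans eq (transposed-combine m′ i′)))
      in cong₂ combine m≡m′ i≡i′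
      where
      transposed-combine : ∀ m i → transposed (combine m i) ≡ combine i m
      transposed-combine m i = cong (uncurry λ m i → combine i m) (remQuot-combine {k = k} m i)

  -- Orders the cells so that the slices in direction `l` become consecutive blocks, each in
  -- lexicographic order.
  sliceOrder : Fin (suc e) → Fin (k ^ suc e) → Fin (k ℕ.* k ^ e)
  sliceOrder l y = combine (coordinates y l) (position l (coordinates y))

  funToFin-coordinates : ∀ y → funToFin (coordinates y) ≡ y
  funToFin-coordinates = funToFin-finToFin {suc e} {k}

  coordinates-injective : ∀ {y z} → coordinates y ≗ coordinates z → y ≡ z
  coordinates-injective {y} {z} eq = trans (sym (funToFin-coordinates y)) (trans (funToFin-cong eq) (funToFin-coordinates z))

  sliceOrder-bijective : ∀ l → Bijective _≡_ _≡_ (sliceOrder l)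
  sliceOrder-bijective l = injective⇒bijective refl λ {y} {z} eq →
    let a≡b , p≡q = combine-injective (coordinates y l) _ _ _ eq in
    coordinates-injective λ j → trans (sym (insertAt-position l (coordinates y) j)) (trans
      (insertAt-cong l (λ i → cong (λ p → finToFun p i) p≡q) a≡b j) (insertAt-position l (coordinates z) j))

  fibrewise-bijective : ∀ {m n} {σ : Fin m → Fin n → Fin n} → (∀ a → IsPermutation (σ a)) → Bijective _≡_ _≡_ (fibrewise σ)
  fibrewise-bijective {σ = σ} perms = injective⇒bijective refl λ {z} {w} → inj z w
    where
    inj : ∀ z w → fibrewise σ z ≡ fibrewise σ w → z ≡ w
    inj = combine-elim _ λ a p → combine-elim _ λ b q eq →
      same a b p q (combine-injective a (σ a p) b (σ b q)
        (trans (sym (fibrewise-combine σ a p)) (trans eq (fibrewise-combine σ b q))))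
      where
      same : ∀ a b p q → a ≡ b × σ a p ≡ σ b q → combine a p ≡ combine b q
      same a a p q (refl , eq) = cong (combine a) (proj₁ (perms a) eq)

  latinSign : Filling → Sign
  latinSign C = sgnLatin {e} {k} (C ∘ funToFin)

  -- Collects the reordering signs that depend only on `e` and `k`, so that they leave the sum over
  -- hypercubes as a common factor. `transposed` turns (symbol, coordinate) into (coordinate,
  -- symbol).
  universalSign : Sign
  universalSign = ∏ˢ λ l → inversionSign transposed Sign.* inversionSign (sliceOrder l)

  module _ T τ C (lists : Lists T (τ , C)) (perms : IsPermutationTable T) (latin : IsLatinFilling C)
           (bij : Bijective _≡_ _≡_ (cells T)) where

    -- Both sides compare the order of the cells by (symbol, index) with the
    -- order by (coordinate l, symbol).
    sign-direction : ∀ l →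
      ∏ˢ (λ m → sgn (T m l)) Sign.* inversionSign transposed ≡
      inversionSign (cells T) Sign.* inversionSign (sliceOrder l) Sign.* ∏ˢ (λ a → sgn (slice C l a))
    sign-direction l = begin
      ∏ˢ (λ m → sgn (T m l)) Sign.* inversionSign transposed
        ≡⟨ cong (Sign._* inversionSign transposed) (inversionSign-fibrewise λ m → T m l) ⟨
      inversionSign (fibrewise λ m → T m l) Sign.* inversionSign transposed
        ≡⟨ inversionSign-∘ (fibrewise-bijective λ m → perms m l) transposed-injective ⟨
      inversionSign (transposed ∘ fibrewise λ m → T m l)
        ≡⟨ inversionSign-cong {f = transposed ∘ fibrewise λ m → T m l} {g = fibrewise (slice C l) ∘ (sliceOrder l ∘ cells T)}
             (combine-elim _ agree) ⟩
      inversionSign (fibrewise (slice C l) ∘ (sliceOrder l ∘ cells T))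
        ≡⟨ inversionSign-∘ (∘-bijective (sliceOrder-bijective l) bij) (proj₁ (fibrewise-bijective (latin l))) ⟩
      inversionSign (sliceOrder l ∘ cells T) Sign.* inversionSign (fibrewise (slice C l))
        ≡⟨ cong₂ Sign._*_ (inversionSign-∘ bij (proj₁ (sliceOrder-bijective l))) (inversionSign-fibrewise (slice C l)) ⟩
      inversionSign (cells T) Sign.* inversionSign (sliceOrder l) Sign.* ∏ˢ (λ a → sgn (slice C l a)) ∎
      where
      open ≡-Reasoning
      agree : ∀ m i → transposed (fibrewise (λ m → T m l) (combine m i)) ≡
                      fibrewise (slice C l) (sliceOrder l (cells T (combine m i)))
      agree m i = begin
        transposed (fibrewise (λ m → T m l) (combine m i))
          ≡⟨ cong transposed (fibrewise-combine (λ m → T m l) m i) ⟩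
        transposed (combine m (T m l i))
          ≡⟨ cong (uncurry λ m i → combine i m) (remQuot-combine m (T m l i)) ⟩
        combine (T m l i) m
          ≡⟨ cong₂ combine (sym x-l) (sym (symbol-cells T τ C lists m i)) ⟩
        combine (x l) (C y)
          ≡⟨ cong (λ y → combine (x l) (C y)) (sym (funToFin-coordinates y)) ⟩
        combine (x l) (C (funToFin x))
          ≡⟨ cong (combine (x l)) (sym (slice-position C l x)) ⟩
        combine (x l) (slice C l (x l) (position l x))
          ≡⟨ fibrewise-combine (slice C l) (x l) (position l x) ⟨
        fibrewise (slice C l) (sliceOrder l y) ∎
        where
        y = cells T (combine m i)
        x = coordinates y
        x-l : x l ≡ T m l i
        x-l = coordinates-cells T m i l

    -- This is the product of `sign-direction` over all `l`: the sign of the listing appears `suc e`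
    -- times, an odd number, and so counts once.
    sign-table : 2 ∤ suc e → ∏ˢ (λ m → sgn (compose (T m))) Sign.* inversionSign (cells T) ≡ universalSign Sign.* latinSign C
    sign-table odd = begin
      ∏ˢ (λ m → sgn (compose (T m))) Sign.* f
        ≡⟨ cong₂ Sign._*_ (∏ˢ-cong λ m → sgn-compose (T m) (perms m)) (sym (∏ˢ-const-odd (suc e) f odd)) ⟩
      ∏ˢ (λ m → ∏ˢ λ l → sgn (T m l)) Sign.* ∏ˢ {suc e} (λ l → f)
        ≡⟨ cong (Sign._* ∏ˢ {suc e} λ l → f) (∏ˢ-comm λ m l → sgn (T m l)) ⟩
      ∏ˢ (λ l → ∏ˢ λ m → sgn (T m l)) Sign.* ∏ˢ {suc e} (λ l → f)
        ≡⟨ ∏ˢ-distrib-* {suc e} (λ l → ∏ˢ λ m → sgn (T m l)) (λ l → f) ⟨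
      ∏ˢ (λ l → ∏ˢ (λ m → sgn (T m l)) Sign.* f)
        ≡⟨ ∏ˢ-cong {suc e} (λ l → rearrange (∏ˢ λ m → sgn (T m l)) t (ρ l) (∏ˢ λ a → sgn (slice C l a)) (sign-direction l)) ⟩
      ∏ˢ (λ l → t Sign.* ρ l Sign.* ∏ˢ (λ a → sgn (slice C l a)))
        ≡⟨ ∏ˢ-distrib-* {suc e} (λ l → t Sign.* ρ l) (λ l → ∏ˢ λ a → sgn (slice C l a)) ⟩
      universalSign Sign.* latinSign C ∎
      where
      open ≡-Reasoning
      f = inversionSign (cells T)
      t = inversionSign transposed
      ρ = inversionSign ∘ sliceOrder

      -- Signs are their own inverses, so `t` and `f` may change sides in `sign-direction`.
      rearrange : ∀ p t r s → p Sign.* t ≡ f Sign.* r Sign.* s → p Sign.* f ≡ t Sign.* r Sign.* s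
      rearrange p t r s eq = begin
        p Sign.* f                            ≡⟨ cong (Sign._* f) (Sign.*-identityʳ p) ⟨
        p Sign.* Sign.+ Sign.* f              ≡⟨ cong (λ u → p Sign.* u Sign.* f) (Sign.s*s≡+ t) ⟨
        p Sign.* (t Sign.* t) Sign.* f        ≡⟨ solve 3 (λ p t f → (p ⊕ (t ⊕ t)) ⊕ f ⊜ f ⊕ ((p ⊕ t) ⊕ t)) refl p t f ⟩
        f Sign.* (p Sign.* t Sign.* t)        ≡⟨ cong (λ u → f Sign.* (u Sign.* t)) eq ⟩
        f Sign.* (f Sign.* r Sign.* s Sign.* t) ≡⟨ solve 4 (λ f r s t → f ⊕ (((f ⊕ r) ⊕ s) ⊕ t) ⊜ (f ⊕ f) ⊕ ((t ⊕ r) ⊕ s)) refl f r s t ⟩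
        f Sign.* f Sign.* (t Sign.* r Sign.* s) ≡⟨ cong (Sign._* (t Sign.* r Sign.* s)) (Sign.s*s≡+ f) ⟩
        t Sign.* r Sign.* s                   ∎
        where open CommutativeMonoidSolver Sign.*-commutativeMonoid using (solve; _⊕_; _⊜_)

-- Repeated values, filtered lists and integers in a ring

injective-or-repeats : ∀ {m n} (f : Fin m → Fin n) → (∃ λ i → ∃ λ j → i < j × f i ≡ f j) ⊎ Injective _≡_ _≡_ f
injective-or-repeats f with any? (λ i → any? λ j → (i <? j) ×-dec (f i ≟ f j))
... | yes repeat = inj₁ repeat
... | no ¬repeat = inj₂ inj
  where
  inj : Injective _≡_ _≡_ f
  inj {i} {j} eq with <-cmp i j
  ... | tri< i<j _ _ = contradiction (i , j , i<j , eq) ¬repeat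
  ... | tri≈ _ i≡j _ = i≡j
  ... | tri> _ _ j<i = contradiction (j , i , j<i , sym eq) ¬repeat

filter-map : ∀ {a b p} {A : Set a} {B : Set b} {P : B → Set p} (P? : Decidable P) (f : A → B) xs →
  filter P? (List.map f xs) ≡ List.map f (filter (P? ∘ f) xs)
filter-map P? f []       = refl
filter-map P? f (x ∷ xs) with does (P? (f x))
... | true  = cong (f x ∷_) (filter-map P? f xs)
... | false = filter-map P? f xs

module _ {c ℓ} (R : CommutativeRing c ℓ) where
  open CommutativeRing R renaming (refl to ≈-refl; sym to ≈-sym; trans to ≈-trans)
  open RingProperties ring using (-‿+-comm; -0#≈0#)
  open SemiringMult semiring using () renaming (_×_ to _×ᴿ_)
  open SetoidReasoning setoid

  fromℤ : ℤ → Carrier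
  fromℤ (ℤ.+ n)  = n ×ᴿ 1#
  fromℤ -[1+ n ] = - (suc n ×ᴿ 1#)

  private
    cancel-1 : ∀ x → 1# + - (1# + x) ≈ - x
    cancel-1 x = begin
      1# + - (1# + x)    ≈⟨ +-congˡ (-‿+-comm 1# x) ⟨
      1# + (- 1# + - x)  ≈⟨ +-assoc 1# (- 1#) (- x) ⟨
      1# + - 1# + - x    ≈⟨ +-congʳ (-‿inverseʳ 1#) ⟩
      0# + - x           ≈⟨ +-identityˡ (- x) ⟩
      - x                ∎

  -- `AT` adds one sign at a time, so additivity of `fromℤ` is established for the summand 1 here
  -- and for -1 below.
  fromℤ-+1 : ∀ z → fromℤ (ℤ.+ 1 ℤ.+ z) ≈ 1# + fromℤ z
  fromℤ-+1 (ℤ.+ n)        = ≈-refl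
  fromℤ-+1 -[1+ zero ]    = ≈-sym (≈-trans (cancel-1 0#) -0#≈0#)
  fromℤ-+1 -[1+ suc n ]   = ≈-sym (cancel-1 (suc n ×ᴿ 1#))

  fromℤ--1 : ∀ z → fromℤ (-[1+ 0 ] ℤ.+ z) ≈ - 1# + fromℤ z
  fromℤ--1 (ℤ.+ zero)  = ≈-trans (-‿cong (+-identityʳ 1#)) (≈-sym (+-identityʳ (- 1#)))
  fromℤ--1 (ℤ.+ suc n) = ≈-sym (≈-trans (≈-sym (+-assoc (- 1#) 1# _)) (≈-trans (+-congʳ (-‿inverseˡ 1#)) (+-identityˡ _)))
  fromℤ--1 -[1+ n ]    = ≈-sym (-‿+-comm 1# (suc n ×ᴿ 1#))

-- The power of the Cayley form and the Alon--Tarsi number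

module _ {c ℓ} (R : CommutativeRing c ℓ) (e k : ℕ) where
  open CommutativeRing R using (Carrier; _≈_; 0#; 1#; -_)
  open Representation R (suc e) k renaming (e to unitVector)
  open Wedge R (suc e) k
  open LatinHypercubes e k
  open PowerExpansion (Ring.semiring ⋀-ring)
  open ListSum (Ring.+-commutativeMonoid ⋀-ring)
  open MultilinearAlgebra.TensorPower R (MultilinearAlgebra.coordinateSpace R k) (suc e) using (⨂; ⨂-cong)
  private
    module R = CommutativeRing R
  open SetoidReasoning (Ring.setoid ⋀-ring)

  private
    N = k ^ e

  basis : Fin (k ^ suc e) → LeftModule.Carrierᴹ V
  basis y = ⨂ λ l → unitVector (coordinates y l)

  ∏-cong : ∀ {n} {x y : Fin n → ⋀} → (∀ i → x i ≈^ y i) → ∏ x ≈^ ∏ y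
  ∏-cong {zero}  eq = ≈-refl
  ∏-cong {suc n} eq = ∧-cong (eq zero) (∏-cong (eq ∘ suc))

  ∏-signed : ∀ {n} (s : Fin n → Sign) (x : Fin n → ⋀) → ∏ (λ i → signed (s i) (x i)) ≈^ signed (∏ˢ s) (∏ x)
  ∏-signed {zero}  s x = ≈-sym (∧-identityˡ _)
  ∏-signed {suc n} s x = begin
    signed (s zero) (x zero) ∧ ∏ (λ i → signed (s (suc i)) (x (suc i)))
      ≈⟨ ∧-cong ≈-refl (∏-signed (s ∘ suc) (x ∘ suc)) ⟩
    signed (s zero) (x zero) ∧ signed (∏ˢ (s ∘ suc)) (∏ (x ∘ suc))
      ≈⟨ ∧-assoc _ _ _ ⟩
    signed (s zero) (x zero ∧ signed (∏ˢ (s ∘ suc)) (∏ (x ∘ suc)))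
      ≈⟨ signed-cong (s zero) (scalar-∧-commute _ _ _) ⟩
    signed (s zero) (signed (∏ˢ (s ∘ suc)) (x zero ∧ ∏ (x ∘ suc)))
      ≈⟨ signed-* (s zero) (∏ˢ (s ∘ suc)) _ ⟨
    signed (∏ˢ s) (∏ x) ∎

  wedge-tabulate : ∀ {m n} (v : Fin n → LeftModule.Carrierᴹ V) (f : Fin m → Fin n) → wedge v (tabulate f) ≡ ∏ (ι ∘ v ∘ f)
  wedge-tabulate {zero}  v f = refl
  wedge-tabulate {suc m} v f = cong (ι (v (f zero)) ∧_) (wedge-tabulate v (f ∘ suc))

  -- Signs are central and move to the front; the `N` products of `k` vectors then flatten into one
  -- product over the places `combine m i`.
  ∏-cayleyTerm : ∀ (T : Table) →
    ∏ (cayleyTerm ∘ T) ≈^ signed (∏ˢ λ m → sgn (compose (T m))) (wedge basis (tabulate (cells T)))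
  ∏-cayleyTerm T = begin
    ∏ (cayleyTerm ∘ T)
      ≈⟨ ∏-signed (λ m → sgn (compose (T m))) _ ⟩
    signed s (∏ λ m → ∏ λ i → ι (⨂ λ l → unitVector (T m l i)))
      ≈⟨ signed-cong s (∏-cong λ m → ∏-cong λ i → ι-cong (⨂-cong λ l j →
           R.reflexive (cong (λ a → unitVector a j) (sym (coordinates-cells T m i l))))) ⟩
    signed s (∏ λ (m : Fin N) → ∏ λ i → ι (basis (cells T (combine m i))))
      ≈⟨ signed-cong s (SumLemmas.sum-combine (Ring.*-monoid ⋀-ring) N {k} (ι ∘ basis ∘ cells T)) ⟨
    signed s (∏ (ι ∘ basis ∘ cells T))
      ≡⟨ cong (signed s) (wedge-tabulate basis (cells T)) ⟨
    signed s (wedge basis (tabulate (cells T))) ∎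
    where
    s = ∏ˢ λ m → sgn (compose (T m))

  top : ⋀
  top = wedge basis (allFin (k ^ suc e))

  tables : List (Table)
  tables = functions N (functions (suc e) (S k))

  orderings : List (Fin N → Fin k → Fin k)
  orderings = functions N (S k)

  -- The summand ignores the ordering, so each hypercube contributes with multiplicity `(k!)^N`.
  cayleyForm-power : 2 ∤ suc e → L^ N (scalar 1#) ≈^
    ∑ (cartesianProduct orderings (latinFillings)) λ (_ , C) → signed (universalSign Sign.* latinSign C) top
  cayleyForm-power odd = begin
    L^ N (scalar 1#)
      ≈⟨ fold-∑ (functions (suc e) (S k)) cayleyTerm N ⟩
    ∑ tables (λ T → ∏ (cayleyTerm ∘ T))
      ≈⟨ ∑-cong tables ∏-cayleyTerm ⟩
    ∑ tables (λ T → signed (∏ˢ λ m → sgn (compose (T m))) (wedge basis (tabulate (cells T))))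
      -- Tables that repeat a cell drop out; every other table corresponds through `Lists` to one
      -- pair of an ordering and a hypercube, and `sign-table` matches the terms.
      ≈⟨ ∑-transfer lists? (All.map left tables-perms)
           (All.map (λ {τC} (perms , latin) → exactlyOne-listing {proj₁ τC} {proj₂ τC} perms latin) fillings-perms)
           (All.map (λ {T} perms → All.map (λ {τC} → agree T perms τC) fillings-perms) tables-perms) ⟩
    ∑ (cartesianProduct orderings latinFillings) (λ (_ , C) → signed (universalSign Sign.* latinSign C) top) ∎
    where
    tables-perms : All IsPermutationTable tables
    tables-perms = all-functions N (all-functions (suc e) (all-S k))

    fillings-perms : All (λ (τ , C) → (∀ m → IsPermutation (τ m)) × IsLatinFilling C) (cartesianProduct orderings latinFillings)
    fillings-perms = all-cartesianProduct (all-functions N (all-S k)) (All.all-filter isLatinFilling? (functions (k ^ suc e) (allFin N)))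

    left : ∀ {T} → IsPermutationTable T →
      signed (∏ˢ λ m → sgn (compose (T m))) (wedge basis (tabulate (cells T))) ≈^ scalar 0#
      ⊎ ExactlyOne (Lists T) (cartesianProduct orderings latinFillings)
    left {T} perms with injective-or-repeats (cells T)
    ... | inj₁ (z , w , z<w , eq) =
      inj₁ (signed-zero (∏ˢ λ m → sgn (compose (T m))) (wedge-repeated basis {f = cells T} z w z<w eq))
    -- There are as many places as cells, so a listing without repetition reaches every cell.
    ... | inj₂ inj = inj₂ (exactlyOne-filling perms (injective⇒bijective (cells-cardinality) inj))

    agree : ∀ T → IsPermutationTable T → ∀ τC →
      (∀ m → IsPermutation (proj₁ τC m)) × IsLatinFilling (proj₂ τC) → Lists T τC →
      signed (∏ˢ λ m → sgn (compose (T m))) (wedge basis (tabulate (cells T))) ≈^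
      signed (universalSign Sign.* latinSign (proj₂ τC)) top
    agree T perms (τ , C) (τ-perms , latin) lists = begin
      signed s (wedge basis (tabulate (cells T)))
        ≈⟨ signed-cong s (wedge-bijective basis bij) ⟩
      signed s (signed (inversionSign (cells T)) top)
        ≈⟨ signed-* s _ _ ⟨
      signed (s Sign.* inversionSign (cells T)) top
        ≈⟨ signed-reflexive (sign-table T τ C lists perms latin bij odd) ⟩
      signed (universalSign Sign.* latinSign C) top ∎
      where
      s = ∏ˢ λ m → sgn (compose (T m))
      bij = cells-bijective T τ C lists τ-perms

  ∑-signs : ∀ {a} {A : Set a} (s : A → Sign) xs →
    ∑ xs (λ x → scalar ⟦ s x ⟧) ≈^ scalar (fromℤ R (foldr ℤ._+_ 0ℤ (List.map (λ x → s x ◃ 1) xs)))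
  ∑-signs s []       = ≈-refl
  ∑-signs s (x ∷ xs) = ≈-trans (⊕-cong ≈-refl (∑-signs s xs))
    (≈-trans (≈-sym (scalar-+ _ _)) (scalar-cong (R.sym (step (s x) _))))
    where
    step : ∀ t z → fromℤ R ((t ◃ 1) ℤ.+ z) ≈ ⟦ t ⟧ R.+ fromℤ R z
    step Sign.+ = fromℤ-+1 R
    step Sign.- = fromℤ--1 R

  AT-latinFillings : AT (suc e) k ≡ foldr ℤ._+_ 0ℤ (List.map (λ C → latinSign C ◃ 1) latinFillings)
  AT-latinFillings = cong (foldr ℤ._+_ 0ℤ) (trans
    (cong (List.map _) (filter-map (isLatin? {e} {k}) (_∘ funToFin) (functions (k ^ suc e) (allFin N))))
    (sym (map-∘ latinFillings)))

  -- Neither the universal sign nor `top` depends on the hypercube, so both factor out.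
  ∑-latinSigns : ∑ latinFillings (λ C → signed (universalSign Sign.* latinSign C) top) ≈^
    signed (universalSign) (scalar (fromℤ R (AT (suc e) k)) ∧ top)
  ∑-latinSigns = begin
    ∑ latinFillings (λ C → signed (u Sign.* latinSign C) top)
      ≈⟨ ∑-cong latinFillings (λ C → signed-* u (latinSign C) top) ⟩
    ∑ latinFillings (λ C → signed u (signed (latinSign C) top))
      ≈⟨ ∑-distribˡ-* latinFillings _ _ ⟨
    signed u (∑ latinFillings (λ C → signed (latinSign C) top))
      ≈⟨ signed-cong u (∑-distribʳ-* latinFillings top _) ⟨
    signed u (∑ latinFillings (λ C → scalar ⟦ latinSign C ⟧) ∧ top)
      ≈⟨ signed-cong u (∧-cong (∑-signs latinSign latinFillings) ≈-refl) ⟩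
    signed u (scalar (fromℤ R (foldr ℤ._+_ 0ℤ (List.map (λ C → latinSign C ◃ 1) latinFillings))) ∧ top)
      ≡⟨ cong (λ z → signed u (scalar (fromℤ R z) ∧ top)) AT-latinFillings ⟨
    signed u (scalar (fromℤ R (AT (suc e) k)) ∧ top) ∎
    where u = universalSign

  AT≡0⇒cayleyForm-power≈0 : 2 ∤ suc e → AT (suc e) k ≡ 0ℤ → L^ N (scalar 1#) ≈^ scalar 0#
  AT≡0⇒cayleyForm-power≈0 odd AT≡0 = begin
    L^ N (scalar 1#)
      ≈⟨ cayleyForm-power odd ⟩
    ∑ (cartesianProduct orderings latinFillings) (λ (_ , C) → signed (universalSign Sign.* latinSign C) top)
      ≈⟨ ∑-cartesianProductWith _,_ orderings latinFillings _ ⟩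
    ∑ orderings (λ _ → ∑ latinFillings λ C → signed (universalSign Sign.* latinSign C) top)
      -- For each ordering the inner sum is `AT` times `top` up to sign, hence zero.
      ≈⟨ ∑-zero orderings (λ _ → ≈-trans ∑-latinSigns (signed-zero (universalSign) (≈-trans
           (∧-cong (scalar-cong (R.reflexive (cong (fromℤ R) AT≡0))) ≈-refl) (∧-zeroˡ top)))) ⟩
    scalar 0# ∎

-- Nonvanishing of 1 in the exterior algebra, and the conclusion

module _ {c ℓ} (R : CommutativeRing c ℓ) (d k : ℕ) where
  open CommutativeRing R using (Carrier; _≈_; 0#; 1#; _+_; _*_)
  open Representation R d k
  private module R = CommutativeRing R
  open CommutativeMonoidSum R.*-commutativeMonoid using (sum-cong-≋; sum-replicate-zero) renaming (sum to ∏ᴿ)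

  -- The augmentation, the algebra homomorphism that kills `V`. It separates `scalar 1#` from
  -- `scalar 0#` as soon as `1#` and `0#` differ.
  constantTerm : ⋀ → Carrier
  constantTerm (scalar a) = a
  constantTerm (ι v)      = 0#
  constantTerm (x ⊕ y)    = constantTerm x + constantTerm y
  constantTerm (x ∧ y)    = constantTerm x * constantTerm y

  constantTerm-cong : ∀ {x y} → x ≈^ y → constantTerm x ≈ constantTerm y
  constantTerm-cong ≈-refl = R.refl
  constantTerm-cong (≈-sym p) = R.sym (constantTerm-cong p)
  constantTerm-cong (≈-trans p q) = R.trans (constantTerm-cong p) (constantTerm-cong q)
  constantTerm-cong (⊕-cong p q) = R.+-cong (constantTerm-cong p) (constantTerm-cong q)
  constantTerm-cong (∧-cong p q) = R.*-cong (constantTerm-cong p) (constantTerm-cong q)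
  constantTerm-cong (scalar-cong p) = p
  constantTerm-cong (ι-cong p) = R.refl
  constantTerm-cong (⊕-assoc x y z) = R.+-assoc _ _ _
  constantTerm-cong (⊕-comm x y) = R.+-comm _ _
  constantTerm-cong (⊕-identityˡ x) = R.+-identityˡ _
  constantTerm-cong (∧-assoc x y z) = R.*-assoc _ _ _
  constantTerm-cong (∧-identityˡ x) = R.*-identityˡ _
  constantTerm-cong (∧-zeroˡ x) = R.zeroˡ _
  constantTerm-cong (∧-distribˡ x y z) = R.distribˡ _ _ _
  constantTerm-cong (∧-distribʳ x y z) = R.distribʳ _ _ _
  constantTerm-cong (scalar-+ a b) = R.refl
  constantTerm-cong (scalar-* a b) = R.refl
  constantTerm-cong (scalar-central a x) = R.*-comm _ _
  constantTerm-cong (ι-+ v w) = R.sym (R.+-identityˡ 0#)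
  constantTerm-cong (ι-* a v) = R.sym (R.zeroʳ a)
  constantTerm-cong (ι-squares v) = R.zeroˡ 0#

  scalar-1-isHWV : IsHWV (λ _ _ → ℤ.+ 0) (scalar 1#)
  scalar-1-isHWV = record
    { weight = λ t → ≈-sym (≈-trans (∧-cong (scalar-cong (trivial t)) ≈-refl) (∧-identityˡ _))
    ; invariant = λ _ _ → ≈-refl
    }
    where
    trivial : ∀ t → character (λ _ _ → ℤ.+ 0) t ≈ 1#
    trivial t = R.trans (sum-cong-≋ {d} {λ l → ∏ᴿ λ i → t l i ^ᶻ (ℤ.+ 0)} λ l → sum-replicate-zero k) (sum-replicate-zero d)

-- For `n = 0` the isomorphism sends the highest weight vector 1 to the power of the Cayley form. If
-- `AT` were zero, this image would vanish and injectivity would identify 1 with 0.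
HLP∅⇒AT≢0 : ∀ {c ℓ} (R : CommutativeRing c ℓ) →
  ¬ CommutativeRing._≈_ R (CommutativeRing.1# R) (CommutativeRing.0# R) →
  ∀ e k → 2 ∤ suc e → Representation.HLP∅ R (suc e) k → AT (suc e) k ≢ 0ℤ
HLP∅⇒AT≢0 R 1≉0 e k odd hlp AT≡0 with f , f≈L^ , iso ← hlp 0 z≤n =
  1≉0 (constantTerm-cong R (suc e) k (injective {one} {zero′} f1≈f0))
  where
  open CommutativeRing R using (0#; 1#)
  open Representation R (suc e) k hiding (e)
  open LeftModuleMorphisms.IsLeftModuleIsomorphism iso using (injective)

  one zero′ : LeftModule.Carrierᴹ (W 0)
  one = scalar 1# , scalar-1-isHWV R (suc e) k
  zero′ = LeftModule.0ᴹ (W 0)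

  L^-zero : ∀ n → L^ n (scalar 0#) ≈^ scalar 0#
  L^-zero zero    = ≈-refl
  L^-zero (suc n) = ≈-trans (∧-cong ≈-refl (L^-zero n)) (Ring.zeroʳ ⋀-ring _)

  f1≈f0 : proj₁ (f one) ≈^ proj₁ (f zero′)
  f1≈f0 = ≈-trans (f≈L^ one) (≈-trans (AT≡0⇒cayleyForm-power≈0 R e k odd AT≡0)
    (≈-trans (≈-sym (L^-zero (k ^ e))) (≈-sym (f≈L^ zero′))))

-- Equality of the real parts, tested with tolerance 1, would give `1 < 1`.
1≉0 : ¬ CommutativeRing._≈_ ℂ (CommutativeRing.1# ℂ) (CommutativeRing.0# ℂ)
1≉0 (1≈0 , _) =
  let M , close = 1≈0 1ℚ (ℚ.positive⁻¹ 1ℚ) in ℚ.<-irrefl refl (close M ℕ.≤-refl)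

proposition1p8 : (d k : ℕ) .{{_ : NonZero d}} → 3 ≤ d → 2 ∤ d → 2 ∣ k →
    Representation.HLP∅ ℂ d k → AT d k ≢ 0ℤ
proposition1p8 (suc e) k _ odd _ hlp = HLP∅⇒AT≢0 ℂ 1≉0 e k odd hlp
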